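{- Let $A$ be a finite alphabet. For every $k$, $TL[\mathsf U,\mathsf S]^k\le TL[X_\phi,Y_\phi]^k$: for every formula of $TL[\mathsf U,\mathsf S]$ with nesting depth of $\mathsf U,\mathsf S$ at most $k$ there is a formula of $TL[X_\phi,Y_\phi]$ of recursion depth at most $k$ defining the same language of nonempty finite words over $A$. Hence $TL[X_\phi,Y_\phi]\equiv LTL\equiv FO[<]$, i.e. the three logics $TL[X_\phi,Y_\phi]$, $LTL=TL[\mathsf U,\mathsf S]$ and first-order logic $FO[<]$ over words define the same class of languages of nonempty finite words over $A$.
   Context: Words $w\in A^+$ have positions $dom(w)=\{1,\dots,|w|\}$. A temporal formula $\phi$ defines the language $\{w\in A^+ \mid w,1\models\phi\}$; in both temporal logics $w,i\models a$ iff $w[i]=a$, and Boolean operators are as usual. **$LTL=TL[\mathsf U,\mathsf S]$**: formulae built from letters $a\in A$ and $\top$ with Boolean connectives and the (strict) modalities - $w,i\models\phi\,\mathsf U\,\psi$ iff for some $m>i$ in $dom(w)$: $w,m\models\psi$ and $w,l\models\phi$ for all $i<l<m$; - $w,i\models\phi\,\mathsf S\,\psi$ iff for some $m<i$ in $dom(w)$: $w,m\models\psi$ and $w,l\models\phi$ for all $m<l<i$. $TL[\mathsf U,\mathsf S]^k$ denotes the formulae in which the modalities $\mathsf U,\mathsf S$ are nested to depth at most $k$. **$TL[X_\phi,Y_\phi]$** (AtNext logic): $\phi ::= \top \mid a \mid X_\phi\phi \mid Y_\phi\phi \mid \phi\lor\phi \mid \neg\phi$, with - $w,i\models X_\phi\psi$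 iff there is $j>i$ with $w,j\models\phi\land\psi$ and $w,k\not\models\phi$ for all $i<k<j$; - $w,i\models Y_\phi\psi$ iff there is $j<i$ with $w,j\models\phi\land\psi$ and $w,k\not\models\phi$ for all $j<k<i$. Recursion depth: $rd(a)=rd(\top)=0$, $rd(\phi_1\lor\phi_2)=\max(rd(\phi_1),rd(\phi_2))$, $rd(\neg\phi)=rd(\phi)$, $rd(X_\zeta\psi)=rd(Y_\zeta\psi)=\max(rd(\zeta)+1,rd(\psi))$. $TL[X_\phi,Y_\phi]^k$ denotes the formulae of recursion depth at most $k$. **$FO[<]$**: first-order sentences over word positions with the order $<$ and unary letter predicates for $a\in A$. -}

module Defs where

open import Data.Fin.Base using (Fin; zero; _<_)
open import Data.List.Base using (lookup)
open import Data.List.NonEmpty.Base using (List⁺; length; toList)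
open import Data.Nat.Base using (ℕ; suc; _⊔_)
open import Data.Product.Base using (Σ; ∃; _×_)
open import Data.Sum.Base using (_⊎_)
open import Data.Unit.Base using (⊤)
open import Data.Vec.Base as Vec using (Vec; []; _∷_)
open import Level using (0ℓ)
open import Relation.Binary.PropositionalEquality.Core using (_≡_)
open import Relation.Nullary.Negation.Core using (¬_)
open import Relation.Unary using (Pred; _≐_)

Language : Set → Set₁
Language A = Pred (List⁺ A) 0ℓ

-- Positions are numbered from zero, so position 1 of a word is `zero`.
Pos : {A : Set} → List⁺ A → Set
Pos w = Fin (length w)

infix 9 _at_
_at_ : {A : Set} (w : List⁺ A) → Pos w → A
w at i = lookup (toList w) i

Definable : {A F : Set} → (F → Language A) → Pred (Language A) 0ℓ
Definable {F = F} language L = Σ F λ φ → L ≐ language φ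

-- Satisfaction below is valued in Set, with the connectives read as ×, ⊎ and ¬.
-- Words are finite, so over an alphabet with decidable equality every
-- satisfaction relation is decidable and this agrees with the classical reading.

module LTL where

  infix  8 _U_ _S_
  infixr 7 not_
  infixr 6 _∧_
  infixr 5 _∨_

  data Formula (A : Set) : Set where
    true    : Formula A
    letter  : A → Formula A
    not_    : Formula A → Formula A
    _∧_ _∨_ : Formula A → Formula A → Formula A
    _U_ _S_ : Formula A → Formula A → Formula A

  depth : {A : Set} → Formula A → ℕ
  depth true       = 0
  depth (letter a) = 0
  depth (not φ)    = depth φ
  depth (φ ∧ ψ)    = depth φ ⊔ depth ψ
  depth (φ ∨ ψ)    = depth φ ⊔ depth ψ
  depth (φ U ψ)    = suc (depth φ ⊔ depth ψ)
  depth (φ S ψ)    = suc (depth φ ⊔ depth ψ)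

  Sat : {A : Set} (w : List⁺ A) → Pos w → Formula A → Set
  Sat w i true       = ⊤
  Sat w i (letter a) = w at i ≡ a
  Sat w i (not φ)    = ¬ Sat w i φ
  Sat w i (φ ∧ ψ)    = Sat w i φ × Sat w i ψ
  Sat w i (φ ∨ ψ)    = Sat w i φ ⊎ Sat w i ψ
  Sat w i (φ U ψ)    =
    ∃ λ m → i < m × Sat w m ψ × (∀ l → i < l → l < m → Sat w l φ)
  Sat w i (φ S ψ)    =
    ∃ λ m → m < i × Sat w m ψ × (∀ l → m < l → l < i → Sat w l φ)

  language : {A : Set} → Formula A → Language A
  language φ w = Sat w zero φ

module AtNext where

  infixr 7 not_
  infixr 5 _∨_
  infixr 8 X[_]_ Y[_]_

  data Formula (A : Set) : Set where
    true          : Formula A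
    letter        : A → Formula A
    X[_]_ Y[_]_   : Formula A → Formula A → Formula A
    _∨_           : Formula A → Formula A → Formula A
    not_          : Formula A → Formula A

  -- Only the subscript of a modality counts towards the recursion depth.
  rd : {A : Set} → Formula A → ℕ
  rd true       = 0
  rd (letter a) = 0
  rd (X[ ζ ] ψ) = suc (rd ζ) ⊔ rd ψ
  rd (Y[ ζ ] ψ) = suc (rd ζ) ⊔ rd ψ
  rd (φ ∨ ψ)    = rd φ ⊔ rd ψ
  rd (not φ)    = rd φ

  Sat : {A : Set} (w : List⁺ A) → Pos w → Formula A → Set
  Sat w i true       = ⊤
  Sat w i (letter a) = w at i ≡ a
  Sat w i (X[ φ ] ψ) =
    ∃ λ j → i < j × (Sat w j φ × Sat w j ψ) × (∀ k → i < k → k < j → ¬ Sat w k φ)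
  Sat w i (Y[ φ ] ψ) =
    ∃ λ j → j < i × (Sat w j φ × Sat w j ψ) × (∀ k → j < k → k < i → ¬ Sat w k φ)
  Sat w i (φ ∨ ψ)    = Sat w i φ ⊎ Sat w i ψ
  Sat w i (not φ)    = ¬ Sat w i φ

  language : {A : Set} → Formula A → Language A
  language φ w = Sat w zero φ

module FO where

  infix  8 _≺_ _≈_
  infixr 7 not_
  infixr 6 _∧_
  infixr 5 _∨_
  infixr 4 all_ ex_

  -- `Formula A n` has its free variables among n de Bruijn indices; a
  -- quantifier binds index zero.
  data Formula (A : Set) (n : ℕ) : Set where
    true    : Formula A n
    letter  : A → Fin n → Formula A n
    _≺_ _≈_ : Fin n → Fin n → Formula A n
    not_    : Formula A n → Formula A n
    _∧_ _∨_ : Formula A n → Formula A n → Formula A n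
    all_    : Formula A (suc n) → Formula A n
    ex_     : Formula A (suc n) → Formula A n

  Sentence : Set → Set
  Sentence A = Formula A 0

  Sat : {A : Set} {n : ℕ} (w : List⁺ A) → Vec (Pos w) n → Formula A n → Set
  Sat w ρ true         = ⊤
  Sat w ρ (letter a x) = w at Vec.lookup ρ x ≡ a
  Sat w ρ (x ≺ y)      = Vec.lookup ρ x < Vec.lookup ρ y
  Sat w ρ (x ≈ y)      = Vec.lookup ρ x ≡ Vec.lookup ρ y
  Sat w ρ (not φ)      = ¬ Sat w ρ φ
  Sat w ρ (φ ∧ ψ)      = Sat w ρ φ × Sat w ρ ψ
  Sat w ρ (φ ∨ ψ)      = Sat w ρ φ ⊎ Sat w ρ ψ
  Sat w ρ (all φ)      = ∀ p → Sat w (p ∷ ρ) φ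
  Sat w ρ (ex φ)       = ∃ λ p → Sat w (p ∷ ρ) φ

  language : {A : Set} → Sentence A → Language A
  language φ w = Sat w [] φ

{-# OPTIONS --safe #-}

-- φ U ψ looks for the nearest position where ¬φ ∨ ψ holds, hence equals
-- X_{¬φ∨ψ} ψ; conversely X_φ ψ is ¬φ U (φ ∧ ψ).  A first-order formula is turned
-- into a finite automaton reading words with marked positions; ∃ becomes a subset
-- construction, and every automaton obtained is aperiodic: u^(N+1) and u^N act
-- alike for some N.  Following Wilke, the transitions of an aperiodic automaton
-- are then defined in future LTL by induction on the number of states and
-- letters.  A letter c acting surjectively acts as the identity and can be
-- erased.  Otherwise c acts through fewer states, and the blocks between
-- consecutive c's, which use fewer letters, become the letters of an automaton
-- on those states.
module Submission where

open import Defs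
open import Data.Bool.Base using (Bool; true; false; _∧_; _∨_; not; if_then_else_; T)
open import Data.Bool.Properties using (T?; if-cong; ∧-zeroʳ; ∨-identityʳ)
open import Data.Empty using (⊥)
open import Data.Fin.Base using (Fin; zero; suc; toℕ; _<_; punchIn; punchOut; combine; funToFin; finToFun)
open import Data.Fin.Induction using (<-wellFounded; >-wellFounded)
open import Data.Fin.Properties
  using (_≟_; _<?_; <-trans; <⇒≢; any?; all?; ¬∀⟶∃¬; ⊎⇔∃; *↔×; 2↔Bool; punchIn-punchOut;
         punchIn-injective; funToFin-finToFin; finToFun-funToFin)
open import Data.Fin.Subset as Subset using (Subset; _∈_)
open import Data.Fin.Subset.Properties using (_∈?_; ∉⊥; ⊆-antisym)
open import Data.List.Base as List using (List; []; _∷_; _++_; null; map; drop)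
open import Data.List.NonEmpty.Base using (List⁺)
open import Data.List.Relation.Unary.All as All using (All; []; _∷_)
open import Data.List.Relation.Unary.All.Properties using (++⁺; map⁺)
open import Data.Maybe.Base using (Maybe; just; nothing; fromMaybe)
open import Data.Nat.Base as ℕ using (ℕ; zero; suc; _+_; _*_; _^_; _≤_; z≤n; s≤s)
open import Data.Nat.GeneralisedArithmetic using (fold)
open import Data.Nat.Properties as ℕ
  using (≤-trans; ⊔-lub; ⊔-mono-≤; m≤n⊔m; m≤n⇒m≤1+n; +-suc; +-comm; +-mono-≤; m≤m+n; m≤n+m;
         suc-injective; m+[n∸m]≡n; _≤?_; ≰⇒>)
open import Data.Product.Base using (Σ; ∃; _×_; _,_; proj₁; proj₂; map₂)
open import Data.Product.Function.NonDependent.Propositional using (_×-⇔_; _×-↔_)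
open import Data.Sum.Base using (_⊎_; inj₁; inj₂; [_,_]′)
open import Data.Sum.Function.Propositional using (_⊎-⇔_)
open import Data.Unit.Base using (⊤)
open import Data.Vec.Base as Vec using (Vec; []; _∷_; tabulate)
open import Data.Vec.Properties using ([]=⇒lookup; lookup⇒[]=; lookup∘tabulate)
open import Function.Base using (_∘_; flip; id)
open import Function.Bundles using (_⇔_; mk⇔; _↔_; mk↔ₛ′; Inverse; Equivalence)
open import Function.Properties.Equivalence using () renaming (refl to ⇔-refl)
open import Function.Properties.Inverse using (↔-sym; ↔-trans; ↔-refl; ↔⇒↣)
open import Function.Related.TypeIsomorphisms using (¬-cong-⇔)
open import Induction.WellFounded using (Acc; acc; WellFounded)
open import Level using (0ℓ)
open import Relation.Binary.Core using (Rel)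
open import Relation.Binary.Definitions
  using (Transitive; DecidableEquality) renaming (Decidable to Decidable₂)
open import Relation.Binary.PropositionalEquality hiding ([_])
open import Relation.Nullary.Decidable using (dec-true; dec-false; via-injection)
open import Relation.Nullary.Decidable.Core
  using (Dec; yes; no; does; proof; _because_; _×-dec_; _⊎-dec_; _→-dec_; ¬?; decidable-stable)
open import Relation.Nullary.Negation.Core using (¬_; contradiction)
open import Relation.Nullary.Reflects
  using (Reflects; ofʸ; ofⁿ; invert; det; T-reflects; ¬-reflects; _×-reflects_; _⊎-reflects_)
open import Relation.Unary using (Pred; Decidable; _⊆_; _≐_)
open import Relation.Unary.Properties using (≐-trans)
open Equivalence using (to; from)

-- The induction on automata is lexicographic with the number of states first: the alphabet of codes
-- has `n ^ n` letters, but the automaton over it has one state fewer. In the passage to LTL,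
-- aperiodicity is used only at a letter acting surjectively, where it excludes nontrivial
-- permutations; elsewhere it is merely carried along. Carrying it through a quantifier is the
-- delicate point, since forgetting part of the letters destroys it in general: identifying `a` with
-- `b` turns `(ab)*` into `(aa)*`. Here only a single mark is forgotten, so in a power of a word all
-- copies but one are read unmarked, and a copy can be added or removed on a side of the mark that
-- has enough of them.

private
  variable
    a k m n  : ℕ
    X S S′   : Set

-- Reflection, equivalences and iteration

reflects-map : ∀ {A B : Set} {b} → A ⇔ B → Reflects A b → Reflects B b
reflects-map A⇔B (ofʸ x)  = ofʸ (Equivalence.to A⇔B x)
reflects-map A⇔B (ofⁿ ¬x) = ofⁿ (¬x ∘ Equivalence.from A⇔B)

reflects-T : ∀ {A : Set} {b} → Reflects A b → T b ⇔ A
reflects-T (ofʸ a)  = mk⇔ (λ _ → a) _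
reflects-T (ofⁿ ¬a) = mk⇔ (λ ()) ¬a

⇔-trans : ∀ {P Q R : Set} → P ⇔ Q → Q ⇔ R → P ⇔ R
⇔-trans f g = mk⇔ (to g ∘ to f) (from f ∘ from g)

∃-cong : ∀ {I : Set} {P Q : I → Set} → (∀ i → P i ⇔ Q i) → ∃ P ⇔ ∃ Q
∃-cong f = mk⇔ (map₂ (to (f _))) (map₂ (from (f _)))

∀-cong : ∀ {I : Set} {P Q : I → Set} → (∀ i → P i ⇔ Q i) → (∀ i → P i) ⇔ (∀ i → Q i)
∀-cong f = mk⇔ (λ p i → to (f i) (p i)) (λ q i → from (f i) (q i))

⇔-sym : ∀ {P Q : Set} → P ⇔ Q → Q ⇔ P
⇔-sym f = mk⇔ (from f) (to f)

fold-natural : {f : S → S} {g : S′ → S′} (h : S → S′) → (∀ s → h (f s) ≡ g (h s)) →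
               ∀ s k → h (fold s f k) ≡ fold (h s) g k
fold-natural h h-f s zero            = refl
fold-natural {g = g} h h-f s (suc k) = trans (h-f _) (cong g (fold-natural h h-f s k))

-- Translations between LTL, AtNext and FO

module _ {n : ℕ} (_⊏_ : Rel (Fin n) 0ℓ) where

  -- The order is a parameter so that the past modalities are the instance at `flip _<_`.
  Until : Pred (Fin n) 0ℓ → Pred (Fin n) 0ℓ → Pred (Fin n) 0ℓ
  Until P Q i = ∃ λ m → i ⊏ m × Q m × (∀ l → i ⊏ l → l ⊏ m → P l)

  -- By computation this is `Until` for `¬ P` and `P × Q`, so `Until-cong` serves the AtNext
  -- modalities as well.
  FirstSuch : Pred (Fin n) 0ℓ → Pred (Fin n) 0ℓ → Pred (Fin n) 0ℓ
  FirstSuch P Q i = ∃ λ j → i ⊏ j × (P j × Q j) × (∀ k → i ⊏ k → k ⊏ j → ¬ P k)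

  module _ {P Q : Pred (Fin n) 0ℓ} where

    Until-cong : ∀ {P′ Q′ : Pred (Fin n) 0ℓ} →
                 (∀ i → P i ⇔ P′ i) → (∀ i → Q i ⇔ Q′ i) → ∀ {i} → Until P Q i ⇔ Until P′ Q′ i
    Until-cong P⇔P′ Q⇔Q′ = mk⇔
      (λ { (m , i⊏m , q , p) → m , i⊏m , to (Q⇔Q′ m) q , λ l i⊏l l⊏m → to (P⇔P′ l) (p l i⊏l l⊏m) })
      (λ { (m , i⊏m , q , p) → m , i⊏m , from (Q⇔Q′ m) q , λ l i⊏l l⊏m → from (P⇔P′ l) (p l i⊏l l⊏m) })

    module _ (_⊏?_ : Decidable₂ _⊏_) (P? : Decidable P) (Q? : Decidable Q) where

      Until? : Decidable (Until P Q)
      Until? i = any? λ m → i ⊏? m ×-dec Q? m ×-dec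
                   all? λ l → i ⊏? l →-dec (l ⊏? m →-dec P? l)

      module _ (⊏-trans : Transitive _⊏_) (⊏-wf : WellFounded _⊏_) where

        -- The given witness `m` need not be the first stop, since `Q` may already hold before it.
        -- Descend to an earlier `Q` as long as there is one; at the end, `P` on the interval and
        -- the absence of `Q` refute both disjuncts.
        nearest : ∀ {i m} → Acc _⊏_ m → i ⊏ m → Q m → (∀ l → i ⊏ l → l ⊏ m → P l) →
                  FirstSuch (λ k → ¬ P k ⊎ Q k) Q i
        nearest {i} {m} (acc rs) i⊏m q p
          with any? (λ k → i ⊏? k ×-dec k ⊏? m ×-dec Q? k)
        ... | yes (k , i⊏k , k⊏m , qk) =
          nearest (rs k⊏m) i⊏k qk λ l i⊏l l⊏k → p l i⊏l (⊏-trans l⊏k k⊏m)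
        ... | no none =
          m , i⊏m , (inj₂ q , q) , λ k i⊏k k⊏m →
            [ (λ ¬p → ¬p (p k i⊏k k⊏m)) , (λ qk → none (k , i⊏k , k⊏m , qk)) ]′

        Until⇔FirstSuch : ∀ {i} → Until P Q i ⇔ FirstSuch (λ k → ¬ P k ⊎ Q k) Q i
        Until⇔FirstSuch = mk⇔
          (λ { (m , i⊏m , q , p) → nearest (⊏-wf m) i⊏m q p })
          (λ { (j , i⊏j , (_ , q) , none) → j , i⊏j , q , λ l i⊏l l⊏j →
                 decidable-stable (P? l) (none l i⊏l l⊏j ∘ inj₁) })

-- First-order formulas have no implication, so the bounds on a quantified position are written as a
-- negated guard or the body. Passing to the disjunction requires deciding the guard.
guarded-⇔ : ∀ {P Q R : Set} → Dec P → Dec Q → (P → Q → R) ⇔ (¬ (P × Q) ⊎ R)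
guarded-⇔ {P} {Q} {R} P? Q? = mk⇔ (case P? Q?)
  λ { (inj₁ ¬pq) p q → contradiction (p , q) ¬pq ; (inj₂ r) _ _ → r }
  where
  case : Dec P → Dec Q → (P → Q → R) → ¬ (P × Q) ⊎ R
  case (yes p) (yes q) f = inj₂ (f p q)
  case (no ¬p) _       f = inj₁ (¬p ∘ proj₁)
  case (yes _) (no ¬q) f = inj₁ (¬q ∘ proj₂)

-- Defs orders the hypotheses of the past modalities from left to right.
flip-between : ∀ {n} {_⊏_ : Rel (Fin n) 0ℓ} {P Q : Pred (Fin n) 0ℓ} {i} →
               (∃ λ m → m ⊏ i × Q m × (∀ l → m ⊏ l → l ⊏ i → P l)) ⇔ Until (flip _⊏_) P Q i
flip-between = mk⇔ (map₂ (map₂ (map₂ λ p l y x → p l x y))) (map₂ (map₂ (map₂ λ p l y x → p l x y)))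

module _ {A : Set} where

  toAtNext : LTL.Formula A → AtNext.Formula A
  toAtNext LTL.true       = AtNext.true
  toAtNext (LTL.letter a) = AtNext.letter a
  toAtNext (LTL.not φ)    = AtNext.not toAtNext φ
  toAtNext (φ LTL.∧ ψ)    = AtNext.not (AtNext.not toAtNext φ AtNext.∨ AtNext.not toAtNext ψ)
  toAtNext (φ LTL.∨ ψ)    = toAtNext φ AtNext.∨ toAtNext ψ
  toAtNext (φ LTL.U ψ)    = AtNext.X[ AtNext.not toAtNext φ AtNext.∨ toAtNext ψ ] toAtNext ψ
  toAtNext (φ LTL.S ψ)    = AtNext.Y[ AtNext.not toAtNext φ AtNext.∨ toAtNext ψ ] toAtNext ψ

  rd-toAtNext : ∀ φ → AtNext.rd (toAtNext φ) ≤ LTL.depth φ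
  rd-toAtNext LTL.true       = z≤n
  rd-toAtNext (LTL.letter a) = z≤n
  rd-toAtNext (LTL.not φ)    = rd-toAtNext φ
  rd-toAtNext (φ LTL.∧ ψ)    = ⊔-mono-≤ (rd-toAtNext φ) (rd-toAtNext ψ)
  rd-toAtNext (φ LTL.∨ ψ)    = ⊔-mono-≤ (rd-toAtNext φ) (rd-toAtNext ψ)
  rd-toAtNext (φ LTL.U ψ)    =
    ⊔-lub (s≤s (⊔-mono-≤ (rd-toAtNext φ) (rd-toAtNext ψ)))
          (m≤n⇒m≤1+n (≤-trans (rd-toAtNext ψ) (m≤n⊔m (LTL.depth φ) _)))
  rd-toAtNext (φ LTL.S ψ)    =
    ⊔-lub (s≤s (⊔-mono-≤ (rd-toAtNext φ) (rd-toAtNext ψ)))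
          (m≤n⇒m≤1+n (≤-trans (rd-toAtNext ψ) (m≤n⊔m (LTL.depth φ) _)))

  fromAtNext : AtNext.Formula A → LTL.Formula A
  fromAtNext AtNext.true           = LTL.true
  fromAtNext (AtNext.letter a)     = LTL.letter a
  fromAtNext (AtNext.X[ φ ] ψ)     = (LTL.not fromAtNext φ) LTL.U (fromAtNext φ LTL.∧ fromAtNext ψ)
  fromAtNext (AtNext.Y[ φ ] ψ)     = (LTL.not fromAtNext φ) LTL.S (fromAtNext φ LTL.∧ fromAtNext ψ)
  fromAtNext (φ AtNext.∨ ψ)        = fromAtNext φ LTL.∨ fromAtNext ψ
  fromAtNext (AtNext.not φ)        = LTL.not fromAtNext φ

  toFO : ∀ {n} → LTL.Formula A → Fin n → FO.Formula A n
  toFO LTL.true       x = FO.true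
  toFO (LTL.letter a) x = FO.letter a x
  toFO (LTL.not φ)    x = FO.not toFO φ x
  toFO (φ LTL.∧ ψ)    x = toFO φ x FO.∧ toFO ψ x
  toFO (φ LTL.∨ ψ)    x = toFO φ x FO.∨ toFO ψ x
  toFO (φ LTL.U ψ)    x =
    FO.ex suc x FO.≺ zero FO.∧ toFO ψ zero FO.∧
      (FO.all (FO.not (suc (suc x) FO.≺ zero FO.∧ zero FO.≺ suc zero)) FO.∨ toFO φ zero)
  toFO (φ LTL.S ψ)    x =
    FO.ex zero FO.≺ suc x FO.∧ toFO ψ zero FO.∧
      (FO.all (FO.not (suc zero FO.≺ zero FO.∧ zero FO.≺ suc (suc x))) FO.∨ toFO φ zero)

  atFirst : LTL.Formula A → FO.Sentence A
  atFirst φ = FO.ex toFO φ zero FO.∧ (FO.all FO.not (zero FO.≺ suc zero))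

  module _ (w : List⁺ A) where

    fromAtNext-correct : ∀ φ i → AtNext.Sat w i φ ⇔ LTL.Sat w i (fromAtNext φ)
    fromAtNext-correct AtNext.true       i = ⇔-refl
    fromAtNext-correct (AtNext.letter a) i = ⇔-refl
    fromAtNext-correct (AtNext.X[ φ ] ψ) i =
      Until-cong _<_ (λ j → ¬-cong-⇔ (fromAtNext-correct φ j))
                     (λ j → fromAtNext-correct φ j ×-⇔ fromAtNext-correct ψ j)
    fromAtNext-correct (AtNext.Y[ φ ] ψ) i =
      ⇔-trans flip-between (⇔-trans
        (Until-cong (flip _<_) (λ j → ¬-cong-⇔ (fromAtNext-correct φ j))
                     (λ j → fromAtNext-correct φ j ×-⇔ fromAtNext-correct ψ j))
        (⇔-sym flip-between))
    fromAtNext-correct (φ AtNext.∨ ψ)    i = fromAtNext-correct φ i ⊎-⇔ fromAtNext-correct ψ i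
    fromAtNext-correct (AtNext.not φ)    i = ¬-cong-⇔ (fromAtNext-correct φ i)

    module _ (_≟A_ : DecidableEquality A) where

      sat? : ∀ φ i → Dec (LTL.Sat w i φ)
      sat? LTL.true       i = yes _
      sat? (LTL.letter a) i = (w at i) ≟A a
      sat? (LTL.not φ)    i = ¬? (sat? φ i)
      sat? (φ LTL.∧ ψ)    i = sat? φ i ×-dec sat? ψ i
      sat? (φ LTL.∨ ψ)    i = sat? φ i ⊎-dec sat? ψ i
      sat? (φ LTL.U ψ)    i = Until? _<_ _<?_ (sat? φ) (sat? ψ) i
      sat? (φ LTL.S ψ)    i = any? λ m → m <? i ×-dec sat? ψ m ×-dec
                                all? λ l → m <? l →-dec (l <? i →-dec sat? φ l)

      toAtNext-correct : ∀ φ i → LTL.Sat w i φ ⇔ AtNext.Sat w i (toAtNext φ)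
      toAtNext-correct LTL.true       i = ⇔-refl
      toAtNext-correct (LTL.letter a) i = ⇔-refl
      toAtNext-correct (LTL.not φ)    i = ¬-cong-⇔ (toAtNext-correct φ i)
      toAtNext-correct (φ LTL.∧ ψ)    i = ⇔-trans
        (mk⇔ (λ { (p , q) → [ (λ ¬p → ¬p p) , (λ ¬q → ¬q q) ]′ })
             (λ h → decidable-stable (sat? φ i) (h ∘ inj₁) , decidable-stable (sat? ψ i) (h ∘ inj₂)))
        (¬-cong-⇔ (¬-cong-⇔ (toAtNext-correct φ i) ⊎-⇔ ¬-cong-⇔ (toAtNext-correct ψ i)))
      toAtNext-correct (φ LTL.∨ ψ)    i = toAtNext-correct φ i ⊎-⇔ toAtNext-correct ψ i
      toAtNext-correct (φ LTL.U ψ)    i = ⇔-trans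
        (Until⇔FirstSuch _<_ _<?_ (sat? φ) (sat? ψ) <-trans <-wellFounded)
        (Until-cong _<_ (λ j → ¬-cong-⇔ (stop j))
           (λ j → stop j ×-⇔ toAtNext-correct ψ j))
        where
        stop : ∀ j → _
        stop j = ¬-cong-⇔ (toAtNext-correct φ j) ⊎-⇔ toAtNext-correct ψ j
      toAtNext-correct (φ LTL.S ψ)    i =
        ⇔-trans flip-between (⇔-trans (⇔-trans
          (Until⇔FirstSuch (flip _<_) (flip _<?_) (sat? φ) (sat? ψ) (flip <-trans) >-wellFounded)
          (Until-cong (flip _<_) (λ j → ¬-cong-⇔ (stop j))
             (λ j → stop j ×-⇔ toAtNext-correct ψ j)))
          (⇔-sym flip-between))
        where
        stop : ∀ j → _
        stop j = ¬-cong-⇔ (toAtNext-correct φ j) ⊎-⇔ toAtNext-correct ψ j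

    toFO-correct : ∀ {n} φ (ρ : Vec (Pos w) n) x →
                   LTL.Sat w (Vec.lookup ρ x) φ ⇔ FO.Sat w ρ (toFO φ x)
    toFO-correct LTL.true       ρ x = ⇔-refl
    toFO-correct (LTL.letter a) ρ x = ⇔-refl
    toFO-correct (LTL.not φ)    ρ x = ¬-cong-⇔ (toFO-correct φ ρ x)
    toFO-correct (φ LTL.∧ ψ)    ρ x = toFO-correct φ ρ x ×-⇔ toFO-correct ψ ρ x
    toFO-correct (φ LTL.∨ ψ)    ρ x = toFO-correct φ ρ x ⊎-⇔ toFO-correct ψ ρ x
    toFO-correct (φ LTL.U ψ)    ρ x = ∃-cong λ m →
      ⇔-refl ×-⇔ toFO-correct ψ (m ∷ ρ) zero ×-⇔ ∀-cong λ l →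
        ⇔-trans (guarded-⇔ (Vec.lookup ρ x <? l) (l <? m))
                (⇔-refl ⊎-⇔ toFO-correct φ (l ∷ m ∷ ρ) zero)
    toFO-correct (φ LTL.S ψ)    ρ x = ∃-cong λ m →
      ⇔-refl ×-⇔ toFO-correct ψ (m ∷ ρ) zero ×-⇔ ∀-cong λ l →
        ⇔-trans (guarded-⇔ (m <? l) (l <? Vec.lookup ρ x))
                (⇔-refl ⊎-⇔ toFO-correct φ (l ∷ m ∷ ρ) zero)

    atFirst-correct : ∀ φ → LTL.language φ w ⇔ FO.language (atFirst φ) w
    atFirst-correct φ = mk⇔
      (λ s → zero , to (toFO-correct φ (zero ∷ []) zero) s , λ _ ())
      (λ { (zero , s , _) → from (toFO-correct φ (zero ∷ []) zero) s
         ; (suc p , _ , none) → contradiction (s≤s z≤n) (none zero) })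

-- Future formulas and separated blocks

untilᴸ : (List X → Bool) → (List X → Bool) → List X → Bool
untilᴸ p q []       = false
untilᴸ p q (x ∷ xs) = q (x ∷ xs) ∨ (p (x ∷ xs) ∧ untilᴸ p q xs)

infixr 7 _and_
infixr 6 _or_
infix  8 _until_

-- Formulas are evaluated on possibly empty words, since blocks can be empty. `until` is non-strict,
-- so that its meaning is a structural recursion on the word.
data Future (a : ℕ) : Set where
  const               : Bool → Future a
  letter              : Fin a → Future a
  neg next            : Future a → Future a
  _and_ _or_ _until_  : Future a → Future a → Future a

⟦_⟧ : Future a → List (Fin a) → Bool
⟦ const b ⟧   w       = b
⟦ letter c ⟧  []      = false
⟦ letter c ⟧  (x ∷ w) = does (x ≟ c)
⟦ neg φ ⟧     w       = not (⟦ φ ⟧ w)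
⟦ next φ ⟧    []      = false
⟦ next φ ⟧    (x ∷ w) = ⟦ φ ⟧ w
⟦ φ and ψ ⟧   w       = ⟦ φ ⟧ w ∧ ⟦ ψ ⟧ w
⟦ φ or ψ ⟧    w       = ⟦ φ ⟧ w ∨ ⟦ ψ ⟧ w
⟦ φ until ψ ⟧ w       = untilᴸ ⟦ φ ⟧ ⟦ ψ ⟧ w

⋁ ⋀ : (Fin n → Future a) → Future a
⋁ {n = zero}  φ = const false
⋁ {n = suc n} φ = φ zero or ⋁ (φ ∘ suc)
⋀ {n = zero}  φ = const true
⋀ {n = suc n} φ = φ zero and ⋀ (φ ∘ suc)

module _ {w : List (Fin a)} where

  ⋁-reflects : {P : Fin n → Set} (φ : Fin n → Future a) →
               (∀ i → Reflects (P i) (⟦ φ i ⟧ w)) → Reflects (∃ P) (⟦ ⋁ φ ⟧ w)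
  ⋁-reflects {n = zero}  φ r = ofⁿ λ ()
  ⋁-reflects {n = suc n} φ r =
    reflects-map ⊎⇔∃ (r zero ⊎-reflects ⋁-reflects (φ ∘ suc) (r ∘ suc))

  ⋀-reflects : {P : Fin n → Set} (φ : Fin n → Future a) →
               (∀ i → Reflects (P i) (⟦ φ i ⟧ w)) → Reflects (∀ i → P i) (⟦ ⋀ φ ⟧ w)
  ⋀-reflects {n = zero}  φ r = ofʸ λ ()
  ⋀-reflects {n = suc n} φ r =
    reflects-map
      (mk⇔ (λ { (p , ps) zero → p ; (p , ps) (suc i) → ps i }) (λ ps → ps zero , ps ∘ suc))
      (r zero ×-reflects ⋀-reflects (φ ∘ suc) (r ∘ suc))

-- Erasing separators

erase : List (Fin (suc a)) → List (Fin a)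
erase []          = []
erase (zero ∷ w)  = erase w
erase (suc b ∷ w) = b ∷ erase w

separator : Future (suc a)
separator = letter zero

-- Inverse image under `erase`: separators are skipped before anything is tested. The right side of
-- `until` must sit at a kept letter, because trailing separators erase to the empty word, where
-- `until` is false even if its right side holds.
unerase : Future a → Future (suc a)
unerase (const b)   = const b
unerase (letter b)  = separator until letter (suc b)
unerase (neg φ)     = neg (unerase φ)
unerase (next φ)    = separator until (neg separator and next (unerase φ))
unerase (φ and ψ)   = unerase φ and unerase ψ
unerase (φ or ψ)    = unerase φ or unerase ψ
unerase (φ until ψ) = (separator or unerase φ) until (neg separator and unerase ψ)

⟦unerase⟧ : (φ : Future a) → ∀ w → ⟦ unerase φ ⟧ w ≡ ⟦ φ ⟧ (erase w)
⟦unerase⟧ (const b)   w           = refl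
⟦unerase⟧ (letter b)  []          = refl
⟦unerase⟧ (letter b)  (zero ∷ w)  = ⟦unerase⟧ (letter b) w
⟦unerase⟧ (letter b)  (suc c ∷ w) = ∨-identityʳ _
⟦unerase⟧ (neg φ)     w           = cong not (⟦unerase⟧ φ w)
⟦unerase⟧ (next φ)    []          = refl
⟦unerase⟧ (next φ)    (zero ∷ w)  = ⟦unerase⟧ (next φ) w
⟦unerase⟧ (next φ)    (suc c ∷ w) = trans (∨-identityʳ _) (⟦unerase⟧ φ w)
⟦unerase⟧ (φ and ψ)   w           = cong₂ _∧_ (⟦unerase⟧ φ w) (⟦unerase⟧ ψ w)
⟦unerase⟧ (φ or ψ)    w           = cong₂ _∨_ (⟦unerase⟧ φ w) (⟦unerase⟧ ψ w)
⟦unerase⟧ (φ until ψ) []          = refl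
⟦unerase⟧ (φ until ψ) (zero ∷ w)  = ⟦unerase⟧ (φ until ψ) w
⟦unerase⟧ (φ until ψ) (suc c ∷ w) =
  cong₂ _∨_ (⟦unerase⟧ ψ (suc c ∷ w))
    (cong₂ _∧_ (⟦unerase⟧ φ (suc c ∷ w)) (⟦unerase⟧ (φ until ψ) w))

-- A word over Fin (suc a) is a sequence of blocks over Fin a separated by
-- occurrences of zero; there is one block more than there are separators.
first : List (Fin (suc a)) → List (Fin a)
first []          = []
first (zero ∷ w)  = []
first (suc b ∷ w) = b ∷ first w

rest : List (Fin (suc a)) → List (List (Fin a))
rest []          = []
rest (zero ∷ w)  = first w ∷ rest w
rest (suc b ∷ w) = rest w

BlockPred : ℕ → Set
BlockPred a = List (Fin a) → List (List (Fin a)) → Bool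

nextᵇ : BlockPred a → BlockPred a
nextᵇ Φ u []       = false
nextᵇ Φ u (v ∷ vs) = Φ v vs

-- Recursion is on the list of blocks rather than through `nextᵇ`, which keeps it structural; the
-- trailing `∧ false` makes both clauses match `untilᵇ-unfold` by computation.
untilᵇ : BlockPred a → BlockPred a → BlockPred a
untilᵇ Φ Ψ u []       = Ψ u [] ∨ (Φ u [] ∧ false)
untilᵇ Φ Ψ u (v ∷ vs) = Ψ u (v ∷ vs) ∨ (Φ u (v ∷ vs) ∧ untilᵇ Φ Ψ v vs)

untilᵇ-unfold : (Φ Ψ : BlockPred a) → ∀ u vs →
                untilᵇ Φ Ψ u vs ≡ Ψ u vs ∨ (Φ u vs ∧ nextᵇ (untilᵇ Φ Ψ) u vs)
untilᵇ-unfold Φ Ψ u []       = refl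
untilᵇ-unfold Φ Ψ u (v ∷ vs) = refl

-- Relativisation to the first block: a separator plays the role of the end of the word, where
-- `letter`, `next` and `until` are false.
local : Future a → Future (suc a)
local (const b)   = const b
local (letter b)  = letter (suc b)
local (neg φ)     = neg (local φ)
local (next φ)    = neg separator and next (local φ)
local (φ and ψ)   = local φ and local ψ
local (φ or ψ)    = local φ or local ψ
local (φ until ψ) = (neg separator and local φ) until (neg separator and local ψ)

⟦local⟧ : (φ : Future a) → ∀ w → ⟦ local φ ⟧ w ≡ ⟦ φ ⟧ (first w)
⟦local⟧ (const b)   w           = refl
⟦local⟧ (letter b)  []          = refl
⟦local⟧ (letter b)  (zero ∷ w)  = refl
⟦local⟧ (letter b)  (suc c ∷ w) = refl
⟦local⟧ (neg φ)     w           = cong not (⟦local⟧ φ w)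
⟦local⟧ (next φ)    []          = refl
⟦local⟧ (next φ)    (zero ∷ w)  = refl
⟦local⟧ (next φ)    (suc c ∷ w) = ⟦local⟧ φ w
⟦local⟧ (φ and ψ)   w           = cong₂ _∧_ (⟦local⟧ φ w) (⟦local⟧ ψ w)
⟦local⟧ (φ or ψ)    w           = cong₂ _∨_ (⟦local⟧ φ w) (⟦local⟧ ψ w)
⟦local⟧ (φ until ψ) []          = refl
⟦local⟧ (φ until ψ) (zero ∷ w)  = refl
⟦local⟧ (φ until ψ) (suc c ∷ w) =
  cong₂ _∨_ (⟦local⟧ ψ (suc c ∷ w))
    (cong₂ _∧_ (⟦local⟧ φ (suc c ∷ w)) (⟦local⟧ (φ until ψ) w))

separated : Future (suc a)
separated = const true until separator

⟦separated⟧ : (w : List (Fin (suc a))) → ⟦ separated ⟧ w ≡ not (null (rest w))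
⟦separated⟧ []          = refl
⟦separated⟧ (zero ∷ w)  = refl
⟦separated⟧ (suc b ∷ w) = ⟦separated⟧ w

nextBlock : Future (suc a) → Future (suc a)
nextBlock φ = neg separator until (separator and next φ)

-- Only block starts may be tested. A later block starts right after a separator, whence `next`; the
-- block at hand has no separator opening it, so its case is unfolded by hand.
untilBlock : Future (suc a) → Future (suc a) → Future (suc a)
untilBlock φ ψ =
  ψ or (φ and ((neg separator or next φ) until (separator and next ψ)))

-- The last block is left out because no separator follows it; it is treated apart through
-- `lastBlock`.
summary : (List (Fin a) → X) → List (Fin a) → List (List (Fin a)) → List X
summary code u []       = []
summary code u (v ∷ vs) = code u ∷ summary code v vs

lastBlock : List (Fin a) → List (List (Fin a)) → List (Fin a)
lastBlock u []       = u
lastBlock u (v ∷ vs) = lastBlock v vs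

endingIn : Future a → Future (suc a)
endingIn φ = untilBlock (const true) (neg separated and local φ)

-- Inverse image under `summary`. The last block corresponds to the empty word of codes, where
-- `letter` and `until` are false; this is what `separated` enforces.
pull : (Fin n → Future a) → Future n → Future (suc a)
pull β (const b)   = const b
pull β (letter t)  = separated and local (β t)
pull β (neg φ)     = neg (pull β φ)
pull β (next φ)    = nextBlock (pull β φ)
pull β (φ and ψ)   = pull β φ and pull β ψ
pull β (φ or ψ)    = pull β φ or pull β ψ
pull β (φ until ψ) = untilBlock (pull β φ) (separated and pull β ψ)

module _ {V : Fin (suc a) → Set} where

  first-All : ∀ {w} → All V w → All (V ∘ suc) (first w)
  first-All []                  = []
  first-All {zero ∷ w}  (v ∷ vs) = []
  first-All {suc b ∷ w} (v ∷ vs) = v ∷ first-All vs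

  rest-All : ∀ {w} → All V w → All (λ u → V zero × All (V ∘ suc) u) (rest w)
  rest-All []                  = []
  rest-All {zero ∷ w}  (v ∷ vs) = (v , first-All vs) ∷ rest-All vs
  rest-All {suc b ∷ w} (v ∷ vs) = rest-All vs

  erase-All : ∀ {w} → All V w → All (V ∘ suc) (erase w)
  erase-All []                  = []
  erase-All {zero ∷ w}  (v ∷ vs) = erase-All vs
  erase-All {suc b ∷ w} (v ∷ vs) = v ∷ erase-All vs

  Describes : Future (suc a) → BlockPred a → Set
  Describes φ Φ = ∀ {w} → All V w → ⟦ φ ⟧ w ≡ Φ (first w) (rest w)

  nextBlock-describes : ∀ φ {Φ} → Describes φ Φ → Describes (nextBlock φ) (nextᵇ Φ)
  nextBlock-describes φ φ≈Φ []                   = refl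
  nextBlock-describes φ φ≈Φ {zero ∷ w}  (v ∷ vs) = trans (∨-identityʳ _) (φ≈Φ vs)
  nextBlock-describes φ φ≈Φ {suc b ∷ w} (v ∷ vs) = nextBlock-describes φ φ≈Φ vs

  untilBlock-describes : ∀ φ ψ {Φ Ψ} → Describes φ Φ → Describes ψ Ψ →
                         Describes (untilBlock φ ψ) (untilᵇ Φ Ψ)
  untilBlock-describes φ ψ {Φ} {Ψ} φ≈Φ ψ≈Ψ = unfolded
    where
    later : Describes ((neg separator or next φ) until (separator and next ψ))
                      (nextᵇ (untilᵇ Φ Ψ))
    unfolded : Describes (untilBlock φ ψ) (untilᵇ Φ Ψ)

    -- Past a separator the scan becomes `untilBlock` on the remaining word by computation, while
    -- any other letter stays inside the block; hence the mutual recursion on the word.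
    later []                   = refl
    later {zero ∷ w}  (v ∷ vs) = unfolded vs
    later {suc b ∷ w} (v ∷ vs) = later vs

    unfolded {w} vs =
      trans (cong₂ _∨_ (ψ≈Ψ vs) (cong₂ _∧_ (φ≈Φ vs) (later vs)))
            (sym (untilᵇ-unfold Φ Ψ (first w) (rest w)))

  endingIn-describes : (φ : Future a) →
                       Describes (endingIn φ) (λ u vs → ⟦ φ ⟧ (lastBlock u vs))
  endingIn-describes φ {w} valid =
    trans (untilBlock-describes (const true) (neg separated and local φ) (λ _ → refl) last-describes valid)
          (collapse (first w) (rest w))
    where
    Ψ : BlockPred a
    Ψ u vs = not (not (null vs)) ∧ ⟦ φ ⟧ u

    last-describes : Describes (neg separated and local φ) Ψ
    last-describes {w} _ = cong₂ _∧_ (cong not (⟦separated⟧ w)) (⟦local⟧ φ w)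

    collapse : ∀ u vs → untilᵇ (λ _ _ → true) Ψ u vs ≡ ⟦ φ ⟧ (lastBlock u vs)
    collapse u []       = ∨-identityʳ _
    collapse u (v ∷ vs) = collapse v vs

  module _ {β : Fin n → Future a} {code : List (Fin a) → Fin n}
           (β-code : ∀ t {u} → All (V ∘ suc) u → ⟦ β t ⟧ u ≡ does (code u ≟ t)) where

    pull-describes : (χ : Future n) →
                     Describes (pull β χ) (λ u vs → ⟦ χ ⟧ (summary code u vs))
    pull-describes (const b) _ = refl
    pull-describes (letter t) {w} valid =
      trans (cong₂ _∧_ (⟦separated⟧ w)
                       (trans (⟦local⟧ (β t) w) (β-code t (first-All valid))))
            (head-test (first w) (rest w))
      where
      head-test : ∀ u vs → not (null vs) ∧ does (code u ≟ t)
                         ≡ ⟦ letter t ⟧ (summary code u vs)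
      head-test u []       = refl
      head-test u (v ∷ vs) = refl
    pull-describes (neg χ) valid = cong not (pull-describes χ valid)
    pull-describes (next χ) {w} valid =
      trans (nextBlock-describes (pull β χ) (pull-describes χ) valid) (tail-test (first w) (rest w))
      where
      tail-test : ∀ u vs → nextᵇ (λ u vs → ⟦ χ ⟧ (summary code u vs)) u vs
                         ≡ ⟦ next χ ⟧ (summary code u vs)
      tail-test u []       = refl
      tail-test u (v ∷ vs) = refl
    pull-describes (χ and θ) valid = cong₂ _∧_ (pull-describes χ valid) (pull-describes θ valid)
    pull-describes (χ or θ)  valid = cong₂ _∨_ (pull-describes χ valid) (pull-describes θ valid)
    pull-describes (χ until θ) {w} valid =
      trans (untilBlock-describes (pull β χ) (separated and pull β θ) (pull-describes χ) separated-θ valid)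
            (collapse (first w) (rest w))
      where
      Φ Ψ : BlockPred a
      Φ u vs = ⟦ χ ⟧ (summary code u vs)
      Ψ u vs = not (null vs) ∧ ⟦ θ ⟧ (summary code u vs)

      separated-θ : Describes (separated and pull β θ) Ψ
      separated-θ {w} valid = cong₂ _∧_ (⟦separated⟧ w) (pull-describes θ valid)

      collapse : ∀ u vs → untilᵇ Φ Ψ u vs ≡ untilᴸ ⟦ χ ⟧ ⟦ θ ⟧ (summary code u vs)
      collapse u []       = ∧-zeroʳ _
      collapse u (v ∷ vs) = cong (λ b → Ψ u (v ∷ vs) ∨ (Φ u (v ∷ vs) ∧ b)) (collapse v vs)

lastBlock-All : {P : Fin a → Set} {Q : List (Fin a) → Set} → (∀ {v} → Q v → All P v) →
                ∀ {u vs} → All P u → All Q vs → All P (lastBlock u vs)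
lastBlock-All f p []       = p
lastBlock-All f p (q ∷ qs) = lastBlock-All f (f q) qs

funToFin-cong : {f g : Fin m → Fin n} → f ≗ g → funToFin f ≡ funToFin g
funToFin-cong {m = zero}  eq = refl
funToFin-cong {m = suc m} eq = cong₂ combine (eq zero) (funToFin-cong (eq ∘ suc))

-- Transitions of aperiodic automata

run : (X → S → S) → List X → S → S
run δ []      s = s
run δ (x ∷ w) s = run δ w (δ x s)

run-++ : (δ : X → S → S) → ∀ u v s → run δ (u ++ v) s ≡ run δ v (run δ u s)
run-++ δ []      v s = refl
run-++ δ (x ∷ u) v s = run-++ δ u v (δ x s)

run-map : ∀ {Y : Set} (δ : X → S → S) (f : Y → X) → ∀ u s →
          run δ (map f u) s ≡ run (δ ∘ f) u s
run-map δ f []      s = refl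
run-map δ f (x ∷ u) s = run-map δ f u (δ (f x) s)

-- Restricted to letters in V: a code of no actual block may act arbitrarily.
Aperiodic : (X → Set) → (X → S → S) → ℕ → Set
Aperiodic V δ N =
  ∀ {w} → All V w → ∀ s → fold s (run δ w) (suc N) ≡ fold s (run δ w) N

fold-surjective : {f : S → S} → (∀ s → ∃ λ r → f r ≡ s) →
                  ∀ k s → ∃ λ r → fold r f k ≡ s
fold-surjective onto zero    s = s , refl
fold-surjective onto (suc k) s with onto s
... | t , refl with fold-surjective onto k t
... | r , refl = r , refl

-- Every state is an `N`-th iterate, and on `N`-th iterates one more application changes nothing.
stable-surjection : {f : S → S} (N : ℕ) → (∀ s → fold s f (suc N) ≡ fold s f N) →
                    (∀ s → ∃ λ r → f r ≡ s) → ∀ s → f s ≡ s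
stable-surjection N stable onto s with fold-surjective onto N s
... | r , refl = stable r

-- That the separator acts as the identity will follow from aperiodicity, which speaks only of
-- letters in `V`. An actual occurrence of `zero` supplies that membership.
run-erase : {δ : Fin (suc a) → S → S} {V : Fin (suc a) → Set} →
            (V zero → ∀ s → δ zero s ≡ s) →
            ∀ {w} → All V w → ∀ s → run δ w s ≡ run (δ ∘ suc) (erase w) s
run-erase fixes []                           s = refl
run-erase {δ = δ} fixes {zero ∷ w}  (v ∷ vs) s =
  trans (cong (run δ w) (fixes v s)) (run-erase fixes vs s)
run-erase {δ = δ} fixes {suc b ∷ w} (v ∷ vs) s = run-erase fixes vs (δ (suc b) s)

aperiodic-suc : {δ : Fin (suc a) → S → S} {V : Fin (suc a) → Set} (N : ℕ) →
                Aperiodic V δ N → Aperiodic (V ∘ suc) (δ ∘ suc) N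
aperiodic-suc {δ = δ} N aperiodic {w} valid s = begin
  fold s (run (δ ∘ suc) w) (suc N)    ≡⟨ lifted (suc N) ⟨
  fold s (run δ (map suc w)) (suc N)  ≡⟨ aperiodic (map⁺ valid) s ⟩
  fold s (run δ (map suc w)) N        ≡⟨ lifted N ⟩
  fold s (run (δ ∘ suc) w) N          ∎
  where
  open ≡-Reasoning
  lifted : ∀ k → fold s (run δ (map suc w)) k ≡ fold s (run (δ ∘ suc) w) k
  lifted = fold-natural id (run-map δ suc w) s

-- If the separator factors through m states, then between separators only those
-- matter, and a block followed by a separator acts on them as a single letter.
-- The new letters are the codes of all maps between states.
module Factored (δ : Fin (suc a) → Fin n → Fin n)
                (ι : Fin m → Fin n) (ε : Fin n → Fin m)
                (factor : ∀ s → ι (ε s) ≡ δ zero s) where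

  δ₁ : Fin a → Fin n → Fin n
  δ₁ = δ ∘ suc

  δ₂ : Fin (n ^ n) → Fin m → Fin m
  δ₂ t s = ε (finToFun t (ι s))

  code : List (Fin a) → Fin (n ^ n)
  code u = funToFin (run δ₁ u)

  -- The state passed in is the one reached just before the separator that opens the next block.
  resume : List (List (Fin a)) → Fin n → Fin n
  resume []       s = s
  resume (v ∷ vs) s = resume vs (run δ₁ v (ι (ε s)))

  run-blocks : ∀ w s → run δ w s ≡ resume (rest w) (run δ₁ (first w) s)
  run-blocks []          s = refl
  run-blocks (zero ∷ w)  s =
    trans (run-blocks w _) (cong (resume (rest w) ∘ run δ₁ (first w)) (sym (factor s)))
  run-blocks (suc b ∷ w) s = run-blocks w _

  resume-summary : ∀ u vs s → resume vs (run δ₁ u (ι s))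
                            ≡ run δ₁ (lastBlock u vs) (ι (run δ₂ (summary code u vs) s))
  resume-summary u []       s = refl
  resume-summary u (v ∷ vs) s =
    trans (resume-summary v vs _)
          (cong (λ t → run δ₁ (lastBlock v vs) (ι (run δ₂ (summary code v vs) (ε t))))
                (sym (finToFun-funToFin (run δ₁ u) (ι s))))

  module _ (β : Fin n → Fin n → Future a) (γ : Fin m → Fin m → Future (n ^ n)) where

    blockCode : Fin (n ^ n) → Future a
    blockCode t = ⋀ λ s → β s (finToFun t s)

    -- Here `r` represents the state right after the last separator: `γ` accounts for the completed
    -- blocks before it, `β` for the last block.
    fromSeparator : Fin m → Fin n → Future (suc a)
    fromSeparator s q = ⋁ λ r → pull blockCode (γ s r) and endingIn (β (ι r) q)

    -- The starting state need not be in the image of `ι`, so the first block is run on all `n`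
    -- states; only after its separator do the `m` states suffice.
    moves : Fin n → Fin n → Future (suc a)
    moves p q = (neg separated and local (β p q))
             or ⋁ λ r → local (β p r) and nextBlock (fromSeparator (ε r) q)

    module _ {V : Fin (suc a) → Set} where

      -- The admissible letters of the new alphabet: codes of admissible blocks, provided that the
      -- separator is admissible too, so that each can be replaced by an admissible word over the
      -- old alphabet.
      Realised : Fin (n ^ n) → Set
      Realised t =
        V zero × ∃ λ u → All (V ∘ suc) u × (∀ s → run δ₁ u s ≡ finToFun t s)

      summary-realised : ∀ {u vs} → All (V ∘ suc) u → All (λ v → V zero × All (V ∘ suc) v) vs →
                         All Realised (summary code u vs)
      summary-realised     valid []              = []
      summary-realised {u} valid ((vz , v) ∷ vs) =
        (vz , u , valid , λ s → sym (finToFun-funToFin (run δ₁ u) s)) ∷ summary-realised v vs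

      -- Each code is replaced by a block realising it, followed by a separator. This transports
      -- aperiodicity from `δ` to `δ₂`.
      simulate : ∀ {ts} → All Realised ts →
                 ∃ λ w → All V w × (∀ s → run δ w (ι s) ≡ ι (run δ₂ ts s))
      simulate [] = [] , [] , λ s → refl
      simulate {t ∷ ts} ((vz , u , valid , realises) ∷ rs) with simulate rs
      ... | w , valid′ , simulates =
        map suc u ++ zero ∷ w , ++⁺ (map⁺ valid) (vz ∷ valid′) , λ s → begin
          run δ (map suc u ++ zero ∷ w) (ι s)    ≡⟨ run-++ δ (map suc u) (zero ∷ w) (ι s) ⟩
          run δ w (δ zero (run δ (map suc u) (ι s)))
            ≡⟨ cong (run δ w ∘ δ zero) (trans (run-map δ suc u (ι s)) (realises (ι s))) ⟩
          run δ w (δ zero (finToFun t (ι s)))    ≡⟨ cong (run δ w) (sym (factor _)) ⟩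
          run δ w (ι (δ₂ t s))                   ≡⟨ simulates (δ₂ t s) ⟩
          ι (run δ₂ ts (δ₂ t s))                 ∎
        where open ≡-Reasoning

      -- Under `ι`, powers of a word of codes become powers of its simulating word, so the exponent
      -- is unchanged and injectivity reflects the equation back.
      aperiodic₂ : (∀ {s t} → ι s ≡ ι t → s ≡ t) → ∀ N →
                   Aperiodic V δ N → Aperiodic Realised δ₂ N
      aperiodic₂ ι-injective N aperiodic {ts} rs s with simulate rs
      ... | w , valid , simulates = ι-injective (begin
          ι (fold s (run δ₂ ts) (suc N))     ≡⟨ iterated (suc N) ⟩
          fold (ι s) (run δ w) (suc N)       ≡⟨ aperiodic valid (ι s) ⟩
          fold (ι s) (run δ w) N             ≡⟨ iterated N ⟨
          ι (fold s (run δ₂ ts) N)           ∎)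
        where
        open ≡-Reasoning
        iterated : ∀ k → ι (fold s (run δ₂ ts) k) ≡ fold (ι s) (run δ w) k
        iterated = fold-natural ι (λ s → sym (simulates s)) s

      module _ (β-correct : ∀ s t {u} → All (V ∘ suc) u → Reflects (run δ₁ u s ≡ t) (⟦ β s t ⟧ u))
               (γ-correct : ∀ s t {ts} → All Realised ts → Reflects (run δ₂ ts s ≡ t) (⟦ γ s t ⟧ ts))
               where

        blockCode-correct : ∀ t {u} → All (V ∘ suc) u → ⟦ blockCode t ⟧ u ≡ does (code u ≟ t)
        blockCode-correct t {u} valid =
          det (reflects-map (mk⇔ sound complete)
                 (⋀-reflects _ λ s → β-correct s (finToFun t s) valid))
              (proof (code u ≟ t))
          where
          sound : (∀ s → run δ₁ u s ≡ finToFun t s) → code u ≡ t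
          sound eq = trans (funToFin-cong eq) (funToFin-finToFin {n} {n} t)
          complete : code u ≡ t → ∀ s → run δ₁ u s ≡ finToFun t s
          complete eq s = trans (sym (finToFun-funToFin (run δ₁ u) s)) (cong (λ c → finToFun c s) eq)

        fromSeparator-correct : ∀ s q {w} → All V w →
          Reflects (resume (rest w) (run δ₁ (first w) (ι s)) ≡ q) (⟦ fromSeparator s q ⟧ w)
        fromSeparator-correct s q {w} valid =
          reflects-map (mk⇔ sound complete) (⋁-reflects _ λ r →
            subst (Reflects _) (sym (pull-describes blockCode-correct (γ s r) valid))
              (γ-correct s r (summary-realised (first-All valid) (rest-All valid)))
            ×-reflects
            subst (Reflects _) (sym (endingIn-describes (β (ι r) q) valid))
              (β-correct (ι r) q (lastBlock-All proj₂ (first-All valid) (rest-All valid))))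
          where
          u  = first w
          vs = rest w
          sound : (∃ λ r → run δ₂ (summary code u vs) s ≡ r × run δ₁ (lastBlock u vs) (ι r) ≡ q) →
               resume vs (run δ₁ u (ι s)) ≡ q
          sound (r , refl , eq) = trans (resume-summary u vs s) eq
          complete : resume vs (run δ₁ u (ι s)) ≡ q →
                 ∃ λ r → run δ₂ (summary code u vs) s ≡ r × run δ₁ (lastBlock u vs) (ι r) ≡ q
          complete eq = _ , refl , trans (sym (resume-summary u vs s)) eq

        Later : Fin n → List (List (Fin a)) → Fin n → Set
        Later q []       r = ⊥
        Later q (v ∷ vs) r = resume vs (run δ₁ v (ι (ε r))) ≡ q

        nextBlock-correct : ∀ r q {w} → All V w →
          Reflects (Later q (rest w) r) (⟦ nextBlock (fromSeparator (ε r) q) ⟧ w)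
        nextBlock-correct r q {w} valid =
          subst (Reflects _)
            (sym (nextBlock-describes (fromSeparator (ε r) q)
                   (λ valid → det (fromSeparator-correct (ε r) q valid) (proof (_ ≟ q))) valid))
            (later (first w) (rest w))
          where
          later : ∀ u vs → Reflects (Later q vs r)
            (nextᵇ (λ u vs → does (resume vs (run δ₁ u (ι (ε r))) ≟ q)) u vs)
          later u []       = ofⁿ λ ()
          later u (v ∷ vs) = proof (_ ≟ q)

        moves-correct : ∀ p q {w} → All V w → Reflects (run δ w p ≡ q) (⟦ moves p q ⟧ w)
        moves-correct p q {w} valid = reflects-map (mk⇔ sound complete)
          ( subst (Reflects _) (cong not (sym (⟦separated⟧ w))) (unseparated (rest w))
              ×-reflects local-β q
          ⊎-reflects ⋁-reflects _ λ r → local-β r ×-reflects nextBlock-correct r q valid)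
          where
          unseparated : ∀ (vs : List (List (Fin a))) → Reflects (vs ≡ []) (not (not (null vs)))
          unseparated []       = ofʸ refl
          unseparated (v ∷ vs) = ofⁿ λ ()

          local-β : ∀ r → Reflects (run δ₁ (first w) p ≡ r) (⟦ local (β p r) ⟧ w)
          local-β r = subst (Reflects _) (sym (⟦local⟧ (β p r) w)) (β-correct p r (first-All valid))

          Decomposed : Set
          Decomposed = (rest w ≡ [] × run δ₁ (first w) p ≡ q)
                     ⊎ ∃ λ r → run δ₁ (first w) p ≡ r × Later q (rest w) r

          sound : Decomposed → run δ w p ≡ q
          sound d rewrite run-blocks w p with rest w | d
          ... | []     | inj₁ (refl , eq)     = eq
          ... | v ∷ vs | inj₂ (_ , refl , eq) = eq

          complete : run δ w p ≡ q → Decomposed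
          complete eq rewrite run-blocks w p with rest w
          ... | []     = inj₁ (refl , eq)
          ... | v ∷ vs = inj₂ (_ , refl , eq)

-- The formulas depend on `δ` alone; `V` and `N` enter only their correctness. The induction
-- hypothesis for `δ₂` can therefore be used with `Realised` as the set of admissible letters.
definesTransitions : ∀ n a (δ : Fin a → Fin n → Fin n) →
  Σ (Fin n → Fin n → Future a) λ φ → ∀ {V} N → Aperiodic V δ N →
    ∀ p q {w} → All V w → Reflects (run δ w p ≡ q) (⟦ φ p q ⟧ w)
definesTransitions zero    a       δ = (λ ()) , λ _ _ ()
definesTransitions (suc m) zero    δ =
  (λ p q → const (does (p ≟ q))) , λ { _ _ p q [] → proof (p ≟ q) }
definesTransitions (suc m) (suc a) δ
  with all? (λ s → any? λ r → δ zero r ≟ s) | definesTransitions (suc m) a (δ ∘ suc)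
... | yes onto | β , β-correct =
  (λ p q → unerase (β p q)) , λ N aperiodic p q {w} valid →
    subst (Reflects _) (sym (⟦unerase⟧ (β p q) w))
      (subst (λ r → Reflects (r ≡ q) (⟦ β p q ⟧ (erase w)))
        (sym (run-erase (λ v → stable-surjection N (aperiodic (v ∷ [])) onto) valid p))
        (β-correct N (aperiodic-suc N aperiodic) p q (erase-All valid)))
... | no ¬onto | β , β-correct
  with missed , ¬hit ← ¬∀⟶∃¬ (suc m) _ (λ s → any? λ r → δ zero r ≟ s) ¬onto =
  -- The separator never reaches `missed`, so it factors through the other `m` states.
  let avoids : ∀ s → missed ≢ δ zero s
      avoids s eq = ¬hit (s , sym eq)
      open Factored δ (punchIn missed) (λ s → punchOut (avoids s))
                    (λ s → punchIn-punchOut (avoids s))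
      γ , γ-correct = definesTransitions m (suc m ^ suc m) δ₂
  in moves β γ , λ N aperiodic → moves-correct β γ
       (β-correct N (aperiodic-suc N aperiodic))
       (γ-correct N (aperiodic₂ β γ (punchIn-injective missed _ _) N aperiodic))

-- Automata for first-order formulas

-- Pigeonhole for a power of a word with one marked copy: `j` copies precede it, `l` follow, and the
-- `suc` counts the marked copy itself.
large-part : ∀ a b j l → a + b ≤ j + suc l → a ≤ j ⊎ b ≤ l
large-part a b j l a+b≤ with a ≤? j | b ≤? l
... | yes a≤j | _       = inj₁ a≤j
... | no  _   | yes b≤l = inj₂ b≤l
... | no  a≰j | no b≰l  =
  contradiction (ℕ.≤-trans (+-mono-≤ (≰⇒> a≰j) (≰⇒> b≰l)) a+b≤) ℕ.1+n≰n

-- Words as functions on positions, the form in which positions assigned to variables can be marked.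
reads : (X → S → S) → (Fin k → X) → S → S
reads {k = zero}  δ w s = s
reads {k = suc k} δ w s = reads δ (w ∘ suc) (δ (w zero) s)

StableAfter : ℕ → (S → S) → Set
StableAfter N f = ∀ s → fold s f (suc N) ≡ fold s f N

stable-from : ∀ N (f : S → S) → StableAfter N f →
              ∀ {k} → N ≤ k → ∀ s → fold s f (suc k) ≡ fold s f k
stable-from N f stable {k} N≤k s = subst (λ k → fold s f (suc k) ≡ fold s f k)
  (trans (+-comm (k ℕ.∸ N) N) (m+[n∸m]≡n N≤k)) (shifted (k ℕ.∸ N))
  where
  shifted : ∀ j → fold s f (suc j + N) ≡ fold s f (j + N)
  shifted zero    = stable s
  shifted (suc j) = cong f (shifted j)

-- Aperiodic automata and their closure properties

record Automaton (X : Set) : Set where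
  field
    size      : ℕ
    step      : X → Fin size → Fin size
    start     : Fin size
    accept    : Fin size → Bool
    exponent  : ℕ
    aperiodic : ∀ {k} (w : Fin k → X) → StableAfter exponent (reads step w)

  accepts : (Fin k → X) → Bool
  accepts w = accept (reads step w start)

module _ (S↔Fin : S ↔ Fin n) (δ : X → S → S) (s₀ : S) (F : S → Bool)
         (N : ℕ) (stable : ∀ {k} (w : Fin k → X) → StableAfter N (reads δ w)) where
  private
    module E = Inverse S↔Fin

    δ′ : X → Fin n → Fin n
    δ′ x = E.to ∘ δ x ∘ E.from

    reads-from : (w : Fin k → X) → ∀ i → E.from (reads δ′ w i) ≡ reads δ w (E.from i)
    reads-from {k = zero}  w i = refl
    reads-from {k = suc k} w i =
      trans (reads-from (w ∘ suc) _) (cong (reads δ (w ∘ suc)) (E.strictlyInverseʳ _))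

    fold-from : (w : Fin k → X) → ∀ i j →
                E.from (fold i (reads δ′ w) j) ≡ fold (E.from i) (reads δ w) j
    fold-from w = fold-natural E.from (reads-from w)

  -- Constructions use whatever state type is natural; numbering the states is needed because
  -- formulas are later built by induction on their number.
  encode : Automaton X
  encode = record
    { size      = n
    ; step      = δ′
    ; start     = E.to s₀
    ; accept    = F ∘ E.from
    ; exponent  = N
    ; aperiodic = λ w i → begin
        fold i (reads δ′ w) (suc N)                ≡⟨ E.strictlyInverseˡ _ ⟨
        E.to (E.from (fold i (reads δ′ w) (suc N)))
          ≡⟨ cong E.to (trans (fold-from w i (suc N))
               (trans (stable w (E.from i)) (sym (fold-from w i N)))) ⟩
        E.to (E.from (fold i (reads δ′ w) N))      ≡⟨ E.strictlyInverseˡ _ ⟩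
        fold i (reads δ′ w) N                      ∎
    }
    where open ≡-Reasoning

  encode-accepts : (w : Fin k → X) → F (reads δ w s₀) ≡ Automaton.accepts encode w
  encode-accepts w = cong F (sym (trans (reads-from w _) (cong (reads δ w) (E.strictlyInverseʳ _))))

module FirstVerdict (verdict : X → Maybe Bool) where

  δ : X → Maybe Bool → Maybe Bool
  δ x (just b) = just b
  δ x nothing  = verdict x

  reads-just : (w : Fin k → X) → ∀ b → reads δ w (just b) ≡ just b
  reads-just {k = zero}  w b = refl
  reads-just {k = suc k} w b = reads-just (w ∘ suc) b

  -- After one reading the state is either a permanent verdict or still `nothing`, in which case
  -- reading the word again starts from the same state.
  stable : (w : Fin k → X) → StableAfter 1 (reads δ w)
  stable w (just b) = cong (reads δ w) (reads-just w b)
  stable w nothing with reads δ w nothing in eq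
  ... | just b  = reads-just w b
  ... | nothing = eq

  reads-first : (w : Fin k → X) → ∀ i {b} → verdict (w i) ≡ just b →
                (∀ j → j < i → verdict (w j) ≡ nothing) → reads δ w nothing ≡ just b
  reads-first w zero    eq none rewrite eq = reads-just (w ∘ suc) _
  reads-first w (suc i) eq none rewrite none zero (s≤s z≤n) =
    reads-first (w ∘ suc) i eq λ j j<i → none (suc j) (s≤s j<i)

  Maybe-Bool↔Fin3 : Maybe Bool ↔ Fin 3
  Maybe-Bool↔Fin3 = mk↔ₛ′
    (λ { nothing → zero ; (just false) → suc zero ; (just true) → suc (suc zero) })
    (λ { zero → nothing ; (suc zero) → just false ; (suc (suc zero)) → just true })
    (λ { zero → refl ; (suc zero) → refl ; (suc (suc zero)) → refl })
    (λ { nothing → refl ; (just false) → refl ; (just true) → refl })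

  automaton : Automaton X
  automaton = encode Maybe-Bool↔Fin3 δ nothing (fromMaybe false) 1 stable

  accepts-first : (w : Fin k → X) → ∀ i {b} → verdict (w i) ≡ just b →
                  (∀ j → j < i → verdict (w j) ≡ nothing) →
                  b ≡ Automaton.accepts automaton w
  accepts-first w i eq none = trans
    (cong (fromMaybe false) (sym (reads-first w i eq none)))
    (encode-accepts Maybe-Bool↔Fin3 δ nothing (fromMaybe false) 1 stable w)

mapAccept : (Bool → Bool) → Automaton X → Automaton X
mapAccept f M = record { Automaton M ; accept = f ∘ Automaton.accept M }

module Product (_∙_ : Bool → Bool → Bool) (M₁ M₂ : Automaton X) where
  private
    module M₁ = Automaton M₁
    module M₂ = Automaton M₂

    State : Set
    State = Fin M₁.size × Fin M₂.size

    δ : X → State → State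
    δ x (s , t) = M₁.step x s , M₂.step x t

    F : State → Bool
    F (s , t) = M₁.accept s ∙ M₂.accept t

    reads-× : (w : Fin k → X) → ∀ s t → reads δ w (s , t) ≡ (reads M₁.step w s , reads M₂.step w t)
    reads-× {k = zero}  w s t = refl
    reads-× {k = suc k} w s t = reads-× (w ∘ suc) _ _

    fold-× : (w : Fin k → X) → ∀ s t j →
             (fold s (reads M₁.step w) j , fold t (reads M₂.step w) j) ≡ fold (s , t) (reads δ w) j
    fold-× w s t j = cong₂ _,_ (sym (fold-natural proj₁ (λ s → cong proj₁ (reads-× w _ _)) (s , t) j))
                               (sym (fold-natural proj₂ (λ s → cong proj₂ (reads-× w _ _)) (s , t) j))

    N : ℕ
    -- Any common upper bound of the two exponents would do, by `stable-from`.
    N = M₁.exponent + M₂.exponent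

    stable : (w : Fin k → X) → StableAfter N (reads δ w)
    stable w (s , t) = begin
      fold (s , t) (reads δ w) (suc N)  ≡⟨ fold-× w s t (suc N) ⟨
      _ , _  ≡⟨ cong₂ _,_ (stable-from M₁.exponent _ (M₁.aperiodic w) (m≤m+n M₁.exponent M₂.exponent) s)
                          (stable-from M₂.exponent _ (M₂.aperiodic w) (m≤n+m M₂.exponent M₁.exponent) t) ⟩
      _ , _  ≡⟨ fold-× w s t N ⟩
      fold (s , t) (reads δ w) N        ∎
      where open ≡-Reasoning

  automaton : Automaton X
  automaton = encode (↔-sym *↔×) δ (M₁.start , M₂.start) F N stable

  accepts-× : (w : Fin k → X) →
              M₁.accepts w ∙ M₂.accepts w ≡ Automaton.accepts automaton w
  accepts-× w = trans (cong F (sym (reads-× w _ _)))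
                      (encode-accepts (↔-sym *↔×) δ _ F N stable w)

Subset↔Fin : ∀ n → Subset n ↔ Fin (2 ^ n)
Subset↔Fin zero    = mk↔ₛ′ (λ _ → zero) (λ _ → []) (λ { zero → refl }) (λ { [] → refl })
Subset↔Fin (suc n) = ↔-trans split (↔-trans (↔-sym 2↔Bool ×-↔ Subset↔Fin n) (↔-sym *↔×))
  where
  split : Subset (suc n) ↔ (Bool × Subset n)
  split = mk↔ₛ′ (λ { (b ∷ p) → b , p }) (λ (b , p) → b ∷ p) (λ _ → refl) (λ { (_ ∷ _) → refl })

filter : {P : Fin n → Set} → Decidable P → Subset n
filter P? = tabulate (does ∘ P?)

∈-filter : {P : Fin n → Set} (P? : Decidable P) → ∀ {i} → i ∈ filter P? ⇔ P i
∈-filter {P = P} P? {i} = mk⇔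
  (λ i∈ → invert (subst (Reflects (P i)) (trans (sym (lookup∘tabulate _ i)) ([]=⇒lookup i∈)) (proof (P? i))))
  (λ p → lookup⇒[]= i _ (trans (lookup∘tabulate _ i) (dec-true (P? i) p)))

markAt : Fin k → (Fin k → X) → Fin k → Bool × X
markAt p w i = does (i ≟ p) , w i

module Projection (M : Automaton (Bool × X)) where
  private
    module M = Automaton M

    State : Set
    State = Fin M.size × Subset M.size

    plain : (Fin k → X) → Fin M.size → Fin M.size
    plain w = reads M.step (λ i → false , w i)

    Next : X → State → Fin M.size → Set
    Next x (q , P) r = (∃ λ p → p ∈ P × M.step (false , x) p ≡ r) ⊎ M.step (true , x) q ≡ r

    next? : ∀ x s → Decidable (Next x s)
    next? x (q , P) r = any? (λ p → p ∈? P ×-dec M.step (false , x) p ≟ r)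
                        ⊎-dec M.step (true , x) q ≟ r

    -- The run without a mark, and the states reached with one mark so far.
    δ : X → State → State
    δ x (q , P) = M.step (false , x) q , filter (next? x (q , P))

    Reached : (Fin k → X) → State → Fin M.size → Set
    Reached w (q , P) r = (∃ λ p → p ∈ P × plain w p ≡ r)
                        ⊎ (∃ λ i → reads M.step (markAt i w) q ≡ r)

    reads-proj₁ : (w : Fin k → X) → ∀ s → proj₁ (reads δ w s) ≡ plain w (proj₁ s)
    reads-proj₁ {k = zero}  w s = refl
    reads-proj₁ {k = suc k} w s = reads-proj₁ (w ∘ suc) _

    reads-proj₂ : (w : Fin k → X) → ∀ s {r} → r ∈ proj₂ (reads δ w s) ⇔ Reached w s r
    reads-proj₂ {k = zero} w s = mk⇔
      (λ r∈ → inj₁ (_ , r∈ , refl))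
      (λ { (inj₁ (_ , p∈ , refl)) → p∈ })
    reads-proj₂ {k = suc k} w s@(q , P) {r} = mk⇔
      (λ r∈ → fwd (to (reads-proj₂ (w ∘ suc) _) r∈))
      (λ reached → from (reads-proj₂ (w ∘ suc) _) (bwd reached))
      where
      fwd : Reached (w ∘ suc) (δ (w zero) s) r → Reached w s r
      fwd (inj₂ (i , eq)) = inj₂ (suc i , eq)
      fwd (inj₁ (_ , p∈ , refl)) with to (∈-filter (next? (w zero) s)) p∈
      ... | inj₁ (p , p∈ , refl) = inj₁ (p , p∈ , refl)
      ... | inj₂ refl            = inj₂ (zero , refl)
      bwd : Reached w s r → Reached (w ∘ suc) (δ (w zero) s) r
      bwd (inj₁ (p , p∈ , eq)) = inj₁ (_ , from (∈-filter (next? (w zero) s)) (inj₁ (p , p∈ , refl)) , eq)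
      bwd (inj₂ (zero , eq))   = inj₁ (_ , from (∈-filter (next? (w zero) s)) (inj₂ refl) , eq)
      bwd (inj₂ (suc i , eq))  = inj₂ (i , eq)

    module _ (w : Fin k → X) (q : Fin M.size) (P : Subset M.size) where

      marked : Fin k → ℕ → ℕ → Fin M.size
      marked i j l = fold (reads M.step (markAt i w) (fold q (plain w) j)) (plain w) l

      -- Among the copies of w read so far, the mark lies in one with j copies
      -- before it and l after it.
      Iterated : ℕ → Fin M.size → Set
      Iterated h r = (∃ λ p → p ∈ P × fold p (plain w) h ≡ r)
                   ⊎ (∃ λ i → ∃ λ j → ∃ λ l → j + suc l ≡ h × marked i j l ≡ r)

      fold-proj₁ : ∀ h → proj₁ (fold (q , P) (reads δ w) h) ≡ fold q (plain w) h
      fold-proj₁ = fold-natural proj₁ (reads-proj₁ w) (q , P)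

      fold-proj₂ : ∀ h {r} → r ∈ proj₂ (fold (q , P) (reads δ w) h) ⇔ Iterated h r
      fold-proj₂ zero = mk⇔
        (λ r∈ → inj₁ (_ , r∈ , refl))
        (λ { (inj₁ (_ , p∈ , refl)) → p∈
           ; (inj₂ (_ , zero , _ , () , _))
           ; (inj₂ (_ , suc _ , _ , () , _)) })
      fold-proj₂ (suc h) {r} = mk⇔
        (λ r∈ → fwd (to (reads-proj₂ w s) r∈))
        (λ it → from (reads-proj₂ w s) (bwd it))
        where
        s : State
        s = fold (q , P) (reads δ w) h
        fwd : Reached w s r → Iterated (suc h) r
        -- The newest copy carries the mark, so all `h` earlier copies are plain and none follows.
        fwd (inj₂ (i , eq)) = inj₂ (i , h , 0 , +-comm h 1 ,
          trans (cong (reads M.step (markAt i w)) (sym (fold-proj₁ h))) eq)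
        fwd (inj₁ (_ , p∈ , refl)) with to (fold-proj₂ h) p∈
        ... | inj₁ (p , p∈ , refl)          = inj₁ (p , p∈ , refl)
        ... | inj₂ (i , j , l , refl , refl) = inj₂ (i , j , suc l , +-suc j (suc l) , refl)
        bwd : Iterated (suc h) r → Reached w s r
        bwd (inj₁ (p , p∈ , refl)) = inj₁ (_ , from (fold-proj₂ h) (inj₁ (p , p∈ , refl)) , refl)
        bwd (inj₂ (i , j , zero , eq , refl)) =
          inj₂ (i , cong (reads M.step (markAt i w))
            (trans (fold-proj₁ h) (cong (fold q (plain w))
              (suc-injective (trans (sym eq) (+-comm j 1))))))
        bwd (inj₂ (i , j , suc l , eq , refl)) =
          inj₁ (_ , from (fold-proj₂ h)
            (inj₂ (i , j , l , suc-injective (trans (sym (+-suc j (suc l))) eq) , refl)) , refl)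

    e N : ℕ
    e = M.exponent
    -- Among `2e + 2` copies, `2e + 1` are unmarked, so one side of the mark has at least `e + 1`
    -- and can lose one while keeping `e`. For adding a copy to `2e + 1`, a side with `e` is enough.
    N = suc (e + e)

    -- Copies before and after the marked one all act by `plain w`, so aperiodicity of `M` on the
    -- unmarked word suffices. The sets of reached states are compared by mutual inclusion, adding
    -- or removing one plain copy.
    stable : (w : Fin k → X) → StableAfter N (reads δ w)
    stable w (q , P) = cong₂ _,_
      (trans (fold-proj₁ w q P (suc N))
        (trans (plain-stable (ℕ.m≤n⇒m≤1+n (m≤m+n e e)) q) (sym (fold-proj₁ w q P N))))
      (⊆-antisym (λ r∈ → from (fold-proj₂ w q P N) (shrink (to (fold-proj₂ w q P (suc N)) r∈)))
                 (λ r∈ → from (fold-proj₂ w q P (suc N)) (grow (to (fold-proj₂ w q P N) r∈))))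
      where
      plain-stable : ∀ {j} → e ≤ j → ∀ s → fold s (plain w) (suc j) ≡ fold s (plain w) j
      plain-stable = stable-from e (plain w) (M.aperiodic (λ i → false , w i))

      earlier : ∀ i {j} l → e ≤ j → marked w q P i (suc j) l ≡ marked w q P i j l
      earlier i l e≤j = cong (λ s → fold (reads M.step (markAt i w) s) (plain w) l) (plain-stable e≤j q)

      later : ∀ i j {l} → e ≤ l → marked w q P i j (suc l) ≡ marked w q P i j l
      later i j e≤l = plain-stable e≤l _

      grow : ∀ {r} → Iterated w q P N r → Iterated w q P (suc N) r
      grow (inj₁ (p , p∈ , eq)) = inj₁ (p , p∈ , trans (plain-stable (ℕ.m≤n⇒m≤1+n (m≤m+n e e)) p) eq)
      grow (inj₂ (i , j , l , sum , eq)) with large-part e e j l (subst (e + e ≤_) (sym sum) (ℕ.n≤1+n _))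
      ... | inj₁ e≤j = inj₂ (i , suc j , l , cong suc sum , trans (earlier i l e≤j) eq)
      ... | inj₂ e≤l = inj₂ (i , j , suc l , trans (+-suc j (suc l)) (cong suc sum) , trans (later i j e≤l) eq)

      shrink : ∀ {r} → Iterated w q P (suc N) r → Iterated w q P N r
      shrink (inj₁ (p , p∈ , eq)) = inj₁ (p , p∈ , trans (sym (plain-stable (ℕ.m≤n⇒m≤1+n (m≤m+n e e)) p)) eq)
      shrink (inj₂ (i , j , l , sum , eq))
        with large-part (suc e) (suc e) j l
               (ℕ.≤-reflexive (trans (cong suc (+-suc e e)) (sym sum)))
      shrink (inj₂ (i , suc j , l , sum , eq)) | inj₁ (s≤s e≤j) =
        inj₂ (i , j , l , suc-injective sum , trans (sym (earlier i l e≤j)) eq)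
      shrink (inj₂ (i , j , suc l , sum , eq)) | inj₂ (s≤s e≤l) =
        inj₂ (i , j , l , suc-injective (trans (sym (+-suc j (suc l))) sum) , trans (sym (later i j e≤l)) eq)

    F : State → Bool
    F (q , P) = does (any? λ r → r ∈? P ×-dec T? (M.accept r))

    State↔Fin : State ↔ Fin (M.size * 2 ^ M.size)
    State↔Fin = ↔-trans (↔-refl ×-↔ Subset↔Fin M.size) (↔-sym *↔×)

  automaton : Automaton X
  automaton = encode State↔Fin δ (M.start , Subset.⊥) F N stable

  projects : (w : Fin k → X) → Reflects (∃ λ i → T (M.accepts (markAt i w))) (Automaton.accepts automaton w)
  projects w = subst (Reflects _) (encode-accepts State↔Fin δ _ F N stable w)
    (reflects-map (mk⇔ fwd bwd) (proof (any? λ r → r ∈? proj₂ final ×-dec T? (M.accept r))))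
    where
    initial final : State
    initial = M.start , Subset.⊥
    final   = reads δ w initial
    fwd : (∃ λ r → r ∈ proj₂ final × T (M.accept r)) → ∃ λ i → T (M.accepts (markAt i w))
    fwd (r , r∈ , ok) with to (reads-proj₂ w initial) r∈
    ... | inj₁ (_ , p∈⊥ , _) = contradiction p∈⊥ ∉⊥
    ... | inj₂ (i , refl)    = i , ok
    bwd : (∃ λ i → T (M.accepts (markAt i w))) → ∃ λ r → r ∈ proj₂ final × T (M.accept r)
    bwd (i , ok) = _ , from (reads-proj₂ w initial) (inj₂ (i , refl)) , ok

-- First-order formulas over words with marked positions

module _ {A : Set} (_≟A_ : DecidableEquality A) where

  Letter : ℕ → Set
  Letter zero    = A
  Letter (suc n) = Bool × Letter n

  symbol : Letter n → A
  symbol {zero}  a       = a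
  symbol {suc n} (_ , x) = symbol x

  marked? : Fin n → Letter n → Bool
  marked? zero    (b , _) = b
  marked? (suc v) (_ , x) = marked? v x

  module _ {k} (w : Fin k → A) where

    annotate : Vec (Fin k) n → Fin k → Letter n
    annotate []      = w
    annotate (p ∷ ρ) = markAt p (annotate ρ)

    symbol-annotate : ∀ (ρ : Vec (Fin k) n) i → symbol (annotate ρ i) ≡ w i
    symbol-annotate []      i = refl
    symbol-annotate (p ∷ ρ) i = symbol-annotate ρ i

    marked-annotate : ∀ (ρ : Vec (Fin k) n) v i →
                      marked? v (annotate ρ i) ≡ does (i ≟ Vec.lookup ρ v)
    marked-annotate (p ∷ ρ) zero    i = refl
    marked-annotate (p ∷ ρ) (suc v) i = marked-annotate ρ v i

    marked-here : ∀ (ρ : Vec (Fin k) n) v → marked? v (annotate ρ (Vec.lookup ρ v)) ≡ true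
    marked-here ρ v = trans (marked-annotate ρ v _) (dec-true (Vec.lookup ρ v ≟ _) refl)

    marked-elsewhere : ∀ (ρ : Vec (Fin k) n) v {i} → i ≢ Vec.lookup ρ v →
                       marked? v (annotate ρ i) ≡ false
    marked-elsewhere ρ v i≢ = trans (marked-annotate ρ v _) (dec-false (_ ≟ _) i≢)

  -- Each variable marks exactly one position, so the first position carrying a
  -- relevant mark decides an atomic formula.
  at-mark : Fin n → (Letter n → Bool) → Letter n → Maybe Bool
  at-mark v test x = if marked? v x then just (test x) else nothing

  before : Fin n → Fin n → Letter n → Maybe Bool
  -- Testing `v` first yields `false` when both marks share a position, as the strict order demands.
  before u v x = if marked? v x then just false else (if marked? u x then just true else nothing)

  automatonFor : FO.Formula A n → Automaton (Letter n)
  automatonFor FO.true         = mapAccept (λ _ → true) (FirstVerdict.automaton (λ _ → nothing))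
  automatonFor (FO.letter a v) = FirstVerdict.automaton (at-mark v λ x → does (symbol x ≟A a))
  automatonFor (u FO.≺ v)      = FirstVerdict.automaton (before u v)
  automatonFor (u FO.≈ v)      = FirstVerdict.automaton (at-mark u (marked? v))
  automatonFor (FO.not φ)      = mapAccept not (automatonFor φ)
  automatonFor (φ FO.∧ ψ)      = Product.automaton _∧_ (automatonFor φ) (automatonFor ψ)
  automatonFor (φ FO.∨ ψ)      = Product.automaton _∨_ (automatonFor φ) (automatonFor ψ)
  automatonFor (FO.all φ)      = mapAccept not (Projection.automaton (mapAccept not (automatonFor φ)))
  automatonFor (FO.ex φ)       = Projection.automaton (automatonFor φ)

  module _ (w : List⁺ A) where

    at-mark-correct : ∀ (ρ : Vec (Pos w) n) v test →
      test (annotate (w at_) ρ (Vec.lookup ρ v))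
      ≡ Automaton.accepts (FirstVerdict.automaton (at-mark v test)) (annotate (w at_) ρ)
    at-mark-correct ρ v test = FirstVerdict.accepts-first _ (annotate (w at_) ρ) (Vec.lookup ρ v)
      (if-cong (marked-here (w at_) ρ v))
      (λ j j<v → if-cong (marked-elsewhere (w at_) ρ v (<⇒≢ j<v)))

    before-correct : ∀ (ρ : Vec (Pos w) n) u v → Reflects (Vec.lookup ρ u < Vec.lookup ρ v)
      (Automaton.accepts (FirstVerdict.automaton (before u v)) (annotate (w at_) ρ))
    before-correct ρ u v with Vec.lookup ρ u <? Vec.lookup ρ v
    ... | yes u<v = subst (Reflects _)
      (FirstVerdict.accepts-first _ (annotate (w at_) ρ) (Vec.lookup ρ u)
        (trans (if-cong (marked-elsewhere (w at_) ρ v (<⇒≢ u<v))) (if-cong (marked-here (w at_) ρ u)))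
        (λ j j<u → trans
          (if-cong (marked-elsewhere (w at_) ρ v (<⇒≢ (<-trans j<u u<v))))
          (if-cong (marked-elsewhere (w at_) ρ u (<⇒≢ j<u)))))
      (ofʸ u<v)
    ... | no u≮v = subst (Reflects _)
      (FirstVerdict.accepts-first _ (annotate (w at_) ρ) (Vec.lookup ρ v)
        (if-cong (marked-here (w at_) ρ v))
        (λ j j<v → trans
          (if-cong (marked-elsewhere (w at_) ρ v (<⇒≢ j<v)))
          (if-cong (marked-elsewhere (w at_) ρ u (<⇒≢ (ℕ.<-≤-trans j<v (ℕ.≮⇒≥ u≮v)))))))
      (ofⁿ u≮v)

    automatonFor-correct : ∀ (φ : FO.Formula A n) ρ →
      Reflects (FO.Sat w ρ φ) (Automaton.accepts (automatonFor φ) (annotate (w at_) ρ))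
    automatonFor-correct FO.true         ρ = ofʸ _
    automatonFor-correct (FO.letter a v) ρ =
      subst (Reflects _) (at-mark-correct ρ v _)
        (subst (λ b → Reflects (b ≡ a) (does (symbol (annotate (w at_) ρ (Vec.lookup ρ v)) ≟A a)))
          (symbol-annotate (w at_) ρ (Vec.lookup ρ v)) (proof (_ ≟A a)))
    automatonFor-correct (u FO.≺ v)      ρ = before-correct ρ u v
    automatonFor-correct (u FO.≈ v)      ρ =
      subst (Reflects _) (trans (sym (marked-annotate (w at_) ρ v _)) (at-mark-correct ρ u _)) (proof (_ ≟ _))
    automatonFor-correct (FO.not φ)      ρ = ¬-reflects (automatonFor-correct φ ρ)
    automatonFor-correct (φ FO.∧ ψ)      ρ =
      subst (Reflects _) (Product.accepts-× _∧_ (automatonFor φ) (automatonFor ψ) (annotate (w at_) ρ))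
        (automatonFor-correct φ ρ ×-reflects automatonFor-correct ψ ρ)
    automatonFor-correct (φ FO.∨ ψ)      ρ =
      subst (Reflects _) (Product.accepts-× _∨_ (automatonFor φ) (automatonFor ψ) (annotate (w at_) ρ))
        (automatonFor-correct φ ρ ⊎-reflects automatonFor-correct ψ ρ)
    automatonFor-correct (FO.all φ)      ρ = reflects-map
      -- The induction hypothesis itself decides `φ` at `p ∷ ρ`, which justifies reading the
      -- universal quantifier as a negated existential one.
      (mk⇔ (λ none p → decidable-stable (_ because automatonFor-correct φ (p ∷ ρ)) λ ¬s →
              none (p , from (reflects-T (¬-reflects (automatonFor-correct φ (p ∷ ρ)))) ¬s))
           (λ { every (p , ok) → to (reflects-T (¬-reflects (automatonFor-correct φ (p ∷ ρ)))) ok (every p) }))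
      (¬-reflects (Projection.projects (mapAccept not (automatonFor φ)) (annotate (w at_) ρ)))
    automatonFor-correct (FO.ex φ)       ρ = reflects-map
      (mk⇔ (map₂ (to (reflects-T (automatonFor-correct φ (_ ∷ ρ)))))
           (map₂ (from (reflects-T (automatonFor-correct φ (_ ∷ ρ))))))
      (Projection.projects (automatonFor φ) (annotate (w at_) ρ))

-- First-order logic to LTL

module _ {X : Set} where

  drop-tabulate : (f : Fin k → X) → ∀ i →
                  drop (toℕ i) (List.tabulate f) ≡ f i ∷ drop (suc (toℕ i)) (List.tabulate f)
  drop-tabulate f zero    = refl
  drop-tabulate f (suc i) = drop-tabulate (f ∘ suc) i

  -- The bridge between the two semantics: a property of positions is tested on the suffix starting
  -- there.
  Tests : (Fin k → X) → (Fin k → Set) → (List X → Bool) → Set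
  Tests f P p = ∀ i → Reflects (P i) (p (drop (toℕ i) (List.tabulate f)))

  untilᴸ-reflects : (f : Fin k → X) {P Q : Fin k → Set} {p q : List X → Bool} →
    Tests f P p → Tests f Q q →
    Reflects (∃ λ m → Q m × (∀ l → l < m → P l)) (untilᴸ p q (List.tabulate f))
  untilᴸ-reflects {k = zero}  f         P-p Q-q = ofⁿ λ ()
  untilᴸ-reflects {k = suc k} f {P} {Q} P-p Q-q = reflects-map (mk⇔ join split)
    (Q-q zero ⊎-reflects P-p zero ×-reflects untilᴸ-reflects (f ∘ suc) (P-p ∘ suc) (Q-q ∘ suc))
    where
    Unfolded : Set
    Unfolded = Q zero ⊎ P zero × ∃ λ m → Q (suc m) × (∀ l → l < m → P (suc l))
    join : Unfolded → ∃ λ m → Q m × (∀ l → l < m → P l)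
    join (inj₁ q₀)               = zero , q₀ , λ _ ()
    join (inj₂ (p₀ , m , q , p)) =
      suc m , q , λ { zero _ → p₀ ; (suc l) (s≤s l<m) → p l l<m }
    split : (∃ λ m → Q m × (∀ l → l < m → P l)) → Unfolded
    split (zero , q , p)  = inj₁ q
    split (suc m , q , p) = inj₂ (p zero (s≤s z≤n) , m , q , λ l l<m → p (suc l) (s≤s l<m))

  -- The strict modality at `i` is the non-strict one on the suffix that starts just after `i`.
  Until-reflects : (f : Fin k → X) {P Q : Fin k → Set} {p q : List X → Bool} →
    Tests f P p → Tests f Q q → ∀ i →
    Reflects (Until _<_ P Q i) (untilᴸ p q (drop (suc (toℕ i)) (List.tabulate f)))
  Until-reflects f P-p Q-q zero = reflects-map
    (mk⇔ (λ { (m , q , p) → suc m , s≤s z≤n , q , λ { (suc l) _ (s≤s l<m) → p l l<m } })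
         (λ { (suc m , _ , q , p) → m , q , λ l l<m → p (suc l) (s≤s z≤n) (s≤s l<m) }))
    (untilᴸ-reflects (f ∘ suc) (P-p ∘ suc) (Q-q ∘ suc))
  Until-reflects f P-p Q-q (suc i) = reflects-map
    (mk⇔ (λ { (m , i<m , q , p) →
                suc m , s≤s i<m , q , λ { (suc l) (s≤s i<l) (s≤s l<m) → p l i<l l<m } })
         (λ { (suc m , s≤s i<m , q , p) →
                m , i<m , q , λ l i<l l<m → p (suc l) (s≤s i<l) (s≤s l<m) }))
    (Until-reflects (f ∘ suc) (P-p ∘ suc) (Q-q ∘ suc) i)

run-lookup : ∀ {Y : Set} (δ : X → S → S) (g : Y → X) w s →
             run (δ ∘ g) w s ≡ reads δ (g ∘ List.lookup w) s
run-lookup δ g []      s = refl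
run-lookup δ g (x ∷ w) s = run-lookup δ g w _

run-tabulate : ∀ {Y : Set} (δ : X → S → S) (g : Y → X) {f : Fin k → X} {h : Fin k → Y} →
               (∀ i → g (h i) ≡ f i) → ∀ s → run (δ ∘ g) (List.tabulate h) s ≡ reads δ f s
run-tabulate {k = zero}  δ g g∘h s = refl
run-tabulate {k = suc k} δ g {f} g∘h s rewrite g∘h zero = run-tabulate δ g (g∘h ∘ suc) (δ (f zero) s)

module _ {A : Set} (A↔Fin : A ↔ Fin n) where
  private
    module E = Inverse A↔Fin

  _≟A_ : DecidableEquality A
  _≟A_ = via-injection (↔⇒↣ A↔Fin) _≟_

  constant : Bool → LTL.Formula A
  constant true  = LTL.true
  constant false = LTL.not LTL.true

  -- The next position need not exist, while next φ may hold at the last one.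
  toLTL : Future n → LTL.Formula A
  toLTL (const b)   = constant b
  toLTL (letter c)  = LTL.letter (E.from c)
  toLTL (neg φ)     = LTL.not toLTL φ
  toLTL (next φ)    = (constant false LTL.U toLTL φ)
              LTL.∨ ((LTL.not (constant false LTL.U LTL.true)) LTL.∧ constant (⟦ φ ⟧ []))
  toLTL (φ and ψ)   = toLTL φ LTL.∧ toLTL ψ
  toLTL (φ or ψ)    = toLTL φ LTL.∨ toLTL ψ
  toLTL (φ until ψ) = toLTL ψ LTL.∨ (toLTL φ LTL.∧ (toLTL φ LTL.U toLTL ψ))

  module _ (w : List⁺ A) where

    letters : Pos w → Fin n
    letters i = E.to (w at i)

    constant-correct : ∀ b i → Reflects (LTL.Sat w i (constant b)) b
    constant-correct true  i = ofʸ _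
    constant-correct false i = ofⁿ λ ¬⊤ → ¬⊤ _

    toLTL-correct : ∀ φ → Tests letters (λ i → LTL.Sat w i (toLTL φ)) ⟦ φ ⟧
    toLTL-correct (const b)   i = constant-correct b i
    toLTL-correct (letter c)  i rewrite drop-tabulate letters i = reflects-map
      (mk⇔ (λ eq → sym (E.inverseʳ (sym eq))) E.inverseˡ) (proof (E.to (w at i) ≟ c))
    toLTL-correct (neg φ)     i = ¬-reflects (toLTL-correct φ i)
    toLTL-correct (next φ)    i rewrite drop-tabulate letters i = subst (Reflects _)
      (collapse (drop (suc (toℕ i)) (List.tabulate letters)))
      (Until-reflects letters (constant-correct false) (toLTL-correct φ) i
        ⊎-reflects ¬-reflects (Until-reflects letters (constant-correct false) (constant-correct true) i)
        ×-reflects constant-correct (⟦ φ ⟧ []) i)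
      where
      collapse : ∀ v → untilᴸ (λ _ → false) ⟦ φ ⟧ v
                     ∨ (not (untilᴸ (λ _ → false) (λ _ → true) v) ∧ ⟦ φ ⟧ []) ≡ ⟦ φ ⟧ v
      collapse []      = refl
      collapse (x ∷ v) = trans (∨-identityʳ _) (∨-identityʳ _)
    toLTL-correct (φ and ψ)   i = toLTL-correct φ i ×-reflects toLTL-correct ψ i
    toLTL-correct (φ or ψ)    i = toLTL-correct φ i ⊎-reflects toLTL-correct ψ i
    toLTL-correct (φ until ψ) i = subst (Reflects _) (sym (unfold i))
      (toLTL-correct ψ i ⊎-reflects toLTL-correct φ i
        ×-reflects Until-reflects letters (toLTL-correct φ) (toLTL-correct ψ) i)
      where
      at : Pos w → List (Fin n)
      at i = drop (toℕ i) (List.tabulate letters)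
      unfold : ∀ i → untilᴸ ⟦ φ ⟧ ⟦ ψ ⟧ (at i) ≡ ⟦ ψ ⟧ (at i)
               ∨ (⟦ φ ⟧ (at i) ∧ untilᴸ ⟦ φ ⟧ ⟦ ψ ⟧ (drop (suc (toℕ i)) (List.tabulate letters)))
      unfold i rewrite drop-tabulate letters i = refl

  module _ (φ : FO.Sentence A) where
    private
      module M = Automaton (automatonFor _≟A_ φ)

      transitions : Σ (Fin M.size → Fin M.size → Future n) _
      transitions = definesTransitions M.size n (M.step ∘ E.from)

      aperiodic : Aperiodic (λ _ → ⊤) (M.step ∘ E.from) M.exponent
      aperiodic {w} _ s = begin
        fold s (run (M.step ∘ E.from) w) (suc M.exponent)                  ≡⟨ folded (suc M.exponent) ⟩
        fold s (reads M.step (E.from ∘ List.lookup w)) (suc M.exponent)    ≡⟨ M.aperiodic (E.from ∘ List.lookup w) s ⟩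
        fold s (reads M.step (E.from ∘ List.lookup w)) M.exponent          ≡⟨ folded M.exponent ⟨
        fold s (run (M.step ∘ E.from) w) M.exponent                        ∎
        where
        open ≡-Reasoning
        folded : ∀ k → fold s (run (M.step ∘ E.from) w) k
                     ≡ fold s (reads M.step (E.from ∘ List.lookup w)) k
        folded = fold-natural id (run-lookup M.step E.from w) s

    accepting : Future n
    accepting = ⋁ λ q → const (M.accept q) and proj₁ transitions M.start q

    fromFO : LTL.Formula A
    fromFO = toLTL accepting

    fromFO-correct : ∀ w → FO.language φ w ⇔ LTL.language fromFO w
    fromFO-correct w = ⇔-trans (⇔-sym (reflects-T (automatonFor-correct _≟A_ w φ [])))
      (⇔-trans (mk⇔ (λ ok → _ , ok , ran) (λ { (q , ok , eq) → subst (T ∘ M.accept) (trans (sym eq) ran) ok }))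
        (⇔-trans (⇔-sym (reflects-T (⋁-reflects _ λ q →
            T-reflects (M.accept q) ×-reflects
            proj₂ transitions M.exponent aperiodic M.start q (All.universal (λ _ → _) (List.tabulate (letters w))))))
          (reflects-T (toLTL-correct w accepting zero))))
      where
      ran : run (M.step ∘ E.from) (List.tabulate (letters w)) M.start ≡ reads M.step (w at_) M.start
      ran = run-tabulate M.step E.from (λ i → E.strictlyInverseʳ (w at i)) M.start

-- Comparison of the classes of definable languages

⇔⇒≐ : {A : Set} {L K : Language A} → (∀ w → L w ⇔ K w) → L ≐ K
⇔⇒≐ L⇔K = (λ {w} → to (L⇔K w)) , (λ {w} → from (L⇔K w))

Definable-⊆ : {A F G : Set} {L : F → Language A} {K : G → Language A} (f : F → G) →
              (∀ φ w → L φ w ⇔ K (f φ) w) → Definable L ⊆ Definable K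
Definable-⊆ f L⇔K (φ , N≐Lφ) = f φ , ≐-trans N≐Lφ (⇔⇒≐ (L⇔K φ))

lemma8 : (A : Set) (n : ℕ) → A ↔ Fin n →
    (∀ k (φ : LTL.Formula A) → LTL.depth φ ≤ k →
    ∃ λ (ψ : AtNext.Formula A) →
    AtNext.rd ψ ≤ k × LTL.language φ ≐ AtNext.language ψ)
    × Definable (AtNext.language {A}) ≐ Definable (LTL.language {A})
    × Definable (LTL.language {A}) ≐ Definable (FO.language {A})
lemma8 A n A↔Fin =
    (λ k φ depth≤k → toAtNext φ , ≤-trans (rd-toAtNext φ) depth≤k , ⇔⇒≐ (ltl⇔atNext φ))
  , ( Definable-⊆ fromAtNext (λ φ w → fromAtNext-correct w φ zero)
    , Definable-⊆ toAtNext ltl⇔atNext )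
  , ( Definable-⊆ atFirst (λ φ w → atFirst-correct w φ)
    , Definable-⊆ (fromFO A↔Fin) (fromFO-correct A↔Fin) )
  where
  ltl⇔atNext : ∀ φ w → LTL.language φ w ⇔ AtNext.language (toAtNext φ) w
  ltl⇔atNext φ w = toAtNext-correct w (_≟A_ A↔Fin) φ zero
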